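{- The rules $i{\uparrow}$, $w{\uparrow}$, $c{\uparrow}$, $u{\uparrow}$ and $n{\uparrow}$ are admissible for system $\mathsf{KSgq}$.
   Context: First-order terms are as usual; atoms are expressions $p(t_1,\dots,t_n)$ with $p$ a predicate symbol of arity $n$, and the negation of an atom is again an atom. Structures: $S ::= \mathsf f \mid \mathsf t \mid a \mid [S,\dots,S] \mid (S,\dots,S) \mid \bar S \mid \exists x S \mid \forall x S$ (non-empty lists), with $[\cdot]$ disjunction, $(\cdot)$ conjunction, $\bar S$ negation. A context $S\{\ \}$ is a structure with one occurrence of a hole, not in the scope of a negation; $S\{R\}$ fills the hole with $R$ (quantifiers of $S$ may capture variables of $R$); $S[R,T]$ abbreviates $S\{[R,T]\}$, $S(R,T)$ abbreviates $S\{(R,T)\}$. $R[x/t]$ denotes substitution of the term $t$ for $x$ in $R$, where $t$ must be free for $x$ in $R$. Equivalent structures are not distinguished; equivalence is the smallest equivalence relation induced by: $[\vec R,[\vec T],\vec U]=[\vec R,\vec T,\vec U]$, $(\vec R,(\vec T),\vec U)=(\vec R,\vec T,\vec U)$ ($\vec T$ non-empty); $[R,T]=[T,R]$, $(R,T)=(T,R)$; $(\mathsf f,\mathsf f)=\mathsf f$, $[\mathsf f,R]=R$, $[\mathsf t,\mathsf t]=\mathsf t$, $(\mathsf t,R)=R$; $\bar{\mathsf f}=\mathsf t$, $\bar{\mathsf t}=\mathsf f$, $\overline{[R,T]}=(\bar R,\bar T)$, $\overline{(R,T)}=[\bar R,\bar T]$, $\bar{\bar R}=R$, $\overline{\exists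 xR}=\forall x\bar R$, $\overline{\forall xR}=\exists x\bar R$; $\forall xR=\forall yR[x/y]$ and $\exists xR=\exists yR[x/y]$ if $y$ is not free in $R$; $\forall yR=\exists yR=R$ if $y$ is not free in $R$; and closure: if $R=T$ then $S\{R\}=S\{T\}$ and $\bar R=\bar T$. A derivation in a system (set of inference rules) is a finite sequence of rule instances, read top-down, the conclusion of each being the premise of the next; it may consist of a single structure. A proof of $R$ is a derivation with premise $\mathsf t$ and conclusion $R$. Rules (written $\frac{\text{premise}}{\text{conclusion}}$): $i{\downarrow}:\frac{S\{\mathsf t\}}{S[R,\bar R]}$, $i{\uparrow}$ (cut)$:\frac{S(R,\bar R)}{S\{\mathsf f\}}$, $s:\frac{S([R,U],T)}{S[(R,T),U]}$, $w{\downarrow}:\frac{S\{\mathsf f\}}{S\{R\}}$, $w{\uparrow}:\frac{S\{R\}}{S\{\mathsf t\}}$, $c{\downarrow}:\frac{S[R,R]}{S\{R\}}$, $c{\uparrow}:\frac{S\{R\}}{S(R,R)}$, $u{\downarrow}:\frac{S\{\forall x[R,T]\}}{S[\forall xR,\exists xT]}$, $u{\uparrow}:\frac{S(\exists xR,\forall xT)}{S\{\exists x(R,T)\}}$, $n{\downarrow}:\frac{S\{R[x/t]\}}{S\{\exists xR\}}$, $n{\uparrow}:\frac{S\{\forall xR\}}{S\{R[x/t]\}}$. System $\mathsf{KSgq}$ is $\{i{\downarrow},s,w{\downarrow},c{\downarrow},u{\downarrow},n{\downarrow}\}$. A rule $\rho$ is admissible for a system $\mathcal S$ if for every proof of a structure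 in $\mathcal S\cup\{\rho\}$ there is a proof of the same structure in $\mathcal S$. -}

module Defs where

open import Data.Bool using (if_then_else_)
open import Data.List using (List; []; _∷_; _++_)
open import Data.List.Membership.Propositional using () renaming (_∈_ to _∈ˡ_)
open import Data.List.NonEmpty using (List⁺; _∷_; toList; _++⁺_; _⁺++_)
open import Data.List.Relation.Unary.All using (All)
open import Data.List.Relation.Unary.Any using () renaming (Any to Anyˡ)
open import Data.Nat using (ℕ; _≟_)
open import Data.Sign using (Sign; opposite)
open import Data.Vec using (Vec; []; _∷_)
open import Data.Vec.Relation.Unary.Any using () renaming (Any to Anyᵛ)
open import Level using (0ℓ)
open import Relation.Binary.PropositionalEquality using (_≢_)
open import Relation.Nullary using (¬_; does)
open import Relation.Unary using (Pred; _∈_; _∪_; ｛_｝)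

record Signature : Set₁ where
  field
    Function       : Set
    functionArity  : Function → ℕ
    Predicate      : Set
    predicateArity : Predicate → ℕ

data Rule : Set where
  i↓ i↑ s w↓ w↑ c↓ c↑ u↓ u↑ n↓ n↑ : Rule

System : Set₁
System = Pred Rule 0ℓ

KSgq : System
KSgq ρ = ρ ∈ˡ (i↓ ∷ s ∷ w↓ ∷ c↓ ∷ u↓ ∷ n↓ ∷ [])

module Calculus (𝓛 : Signature) where

  open Signature 𝓛

  Variable : Set
  Variable = ℕ

  data Term : Set where
    var : Variable → Term
    fun : (f : Function) → Vec Term (functionArity f) → Term

  -- Sign.- marks the negation of p(t₁,…,tₙ), which is itself an atom.
  record Atom : Set where
    constructor mkAtom
    field
      sign      : Sign
      predicate : Predicate
      arguments : Vec Term (predicateArity predicate)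

  open Atom

  dual : Atom → Atom
  dual a = record a { sign = opposite (sign a) }

  data Structure : Set where
    𝖿 𝗍       : Structure
    atom      : Atom → Structure
    disj conj : List⁺ Structure → Structure
    neg       : Structure → Structure
    ex all    : Variable → Structure → Structure

  infixr 6 _∧_
  infixr 5 _∨_

  _∨_ _∧_ : Structure → Structure → Structure
  R ∨ T = disj (R ∷ T ∷ [])
  R ∧ T = conj (R ∷ T ∷ [])

  data _OccursIn_ (x : Variable) : Term → Set where
    var : x OccursIn var x
    fun : ∀ {f ts} → Anyᵛ (x OccursIn_) ts → x OccursIn fun f ts

  data _FreeIn_ (x : Variable) : Structure → Set where
    atom : ∀ {a} → Anyᵛ (x OccursIn_) (arguments a) → x FreeIn atom a
    disj : ∀ {Rs} → Anyˡ (x FreeIn_) (toList Rs) → x FreeIn disj Rs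
    conj : ∀ {Rs} → Anyˡ (x FreeIn_) (toList Rs) → x FreeIn conj Rs
    neg  : ∀ {R} → x FreeIn R → x FreeIn neg R
    ex   : ∀ {y R} → x ≢ y → x FreeIn R → x FreeIn ex y R
    all  : ∀ {y R} → x ≢ y → x FreeIn R → x FreeIn all y R

  -- FreeFor t x R: no free occurrence of x in R lies in the scope of a
  -- quantifier that binds a variable of t.
  data FreeFor (t : Term) (x : Variable) : Structure → Set where
    𝖿    : FreeFor t x 𝖿
    𝗍    : FreeFor t x 𝗍
    atom : ∀ {a} → FreeFor t x (atom a)
    disj : ∀ {Rs} → All (FreeFor t x) (toList Rs) → FreeFor t x (disj Rs)
    conj : ∀ {Rs} → All (FreeFor t x) (toList Rs) → FreeFor t x (conj Rs)
    neg  : ∀ {R} → FreeFor t x R → FreeFor t x (neg R)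
    ex-notFree  : ∀ {y R} → ¬ x FreeIn ex y R → FreeFor t x (ex y R)
    ex-noClash  : ∀ {y R} → ¬ y OccursIn t → FreeFor t x R → FreeFor t x (ex y R)
    all-notFree : ∀ {y R} → ¬ x FreeIn all y R → FreeFor t x (all y R)
    all-noClash : ∀ {y R} → ¬ y OccursIn t → FreeFor t x R → FreeFor t x (all y R)

  mutual
    substTerm : Variable → Term → Term → Term
    substTerm x t (var y)    = if does (x ≟ y) then t else var y
    substTerm x t (fun f us) = fun f (substTerms x t us)

    substTerms : ∀ {n} → Variable → Term → Vec Term n → Vec Term n
    substTerms x t []       = []
    substTerms x t (u ∷ us) = substTerm x t u ∷ substTerms x t us

  -- Substitution for the free occurrences of x.  It does not rename bound
  -- variables, so every use below is guarded by FreeFor.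
  infix 8 _[_/_]

  mutual
    _[_/_] : Structure → Variable → Term → Structure
    𝖿 [ x / t ]               = 𝖿
    𝗍 [ x / t ]               = 𝗍
    atom a [ x / t ]          = atom (record a { arguments = substTerms x t (arguments a) })
    disj (R ∷ Rs) [ x / t ]   = disj (R [ x / t ] ∷ substList x t Rs)
    conj (R ∷ Rs) [ x / t ]   = conj (R [ x / t ] ∷ substList x t Rs)
    neg R [ x / t ]           = neg (R [ x / t ])
    ex y R [ x / t ]          = ex y (if does (x ≟ y) then R else R [ x / t ])
    all y R [ x / t ]         = all y (if does (x ≟ y) then R else R [ x / t ])

    substList : Variable → Term → List Structure → List Structure
    substList x t []       = []
    substList x t (R ∷ Rs) = R [ x / t ] ∷ substList x t Rs

  data Context : Set where
    hole      : Context
    disj conj : List Structure → Context → List Structure → Context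
    ex all    : Variable → Context → Context

  infix 9 _⟨_⟩

  _⟨_⟩ : Context → Structure → Structure
  hole ⟨ R ⟩         = R
  disj Ts S Us ⟨ R ⟩ = disj (Ts ++⁺ (S ⟨ R ⟩ ∷ Us))
  conj Ts S Us ⟨ R ⟩ = conj (Ts ++⁺ (S ⟨ R ⟩ ∷ Us))
  ex x S ⟨ R ⟩       = ex x (S ⟨ R ⟩)
  all x S ⟨ R ⟩      = all x (S ⟨ R ⟩)

  infix 4 _≈_

  data _≈_ : Structure → Structure → Set where
    ≈-refl  : ∀ {R} → R ≈ R
    ≈-sym   : ∀ {R T} → R ≈ T → T ≈ R
    ≈-trans : ∀ {R T U} → R ≈ T → T ≈ U → R ≈ U

    ctx-cong : ∀ S {R T} → R ≈ T → S ⟨ R ⟩ ≈ S ⟨ T ⟩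
    neg-cong : ∀ {R T} → R ≈ T → neg R ≈ neg T

    disj-assoc : ∀ Rs Ts Us → disj (Rs ++⁺ (disj Ts ∷ Us)) ≈ disj (Rs ++⁺ (Ts ⁺++ Us))
    conj-assoc : ∀ Rs Ts Us → conj (Rs ++⁺ (conj Ts ∷ Us)) ≈ conj (Rs ++⁺ (Ts ⁺++ Us))
    disj-comm  : ∀ R T → R ∨ T ≈ T ∨ R
    conj-comm  : ∀ R T → R ∧ T ≈ T ∧ R

    𝖿∧𝖿 : 𝖿 ∧ 𝖿 ≈ 𝖿
    𝖿∨  : ∀ R → 𝖿 ∨ R ≈ R
    𝗍∨𝗍 : 𝗍 ∨ 𝗍 ≈ 𝗍
    𝗍∧  : ∀ R → 𝗍 ∧ R ≈ R

    neg-𝖿    : neg 𝖿 ≈ 𝗍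
    neg-𝗍    : neg 𝗍 ≈ 𝖿
    neg-atom : ∀ a → neg (atom a) ≈ atom (dual a)
    neg-disj : ∀ R T → neg (R ∨ T) ≈ neg R ∧ neg T
    neg-conj : ∀ R T → neg (R ∧ T) ≈ neg R ∨ neg T
    neg-neg  : ∀ R → neg (neg R) ≈ R
    neg-ex   : ∀ x R → neg (ex x R) ≈ all x (neg R)
    neg-all  : ∀ x R → neg (all x R) ≈ ex x (neg R)

    all-rename : ∀ {x y R} → ¬ y FreeIn R → FreeFor (var y) x R →
                 all x R ≈ all y (R [ x / var y ])
    ex-rename  : ∀ {x y R} → ¬ y FreeIn R → FreeFor (var y) x R →
                 ex x R ≈ ex y (R [ x / var y ])
    all-vacuous : ∀ {y R} → ¬ y FreeIn R → all y R ≈ R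
    ex-vacuous  : ∀ {y R} → ¬ y FreeIn R → ex y R ≈ R

  -- Instance ρ P C: P is the premise and C the conclusion of an instance of ρ.
  data Instance : Rule → Structure → Structure → Set where
    i↓ : ∀ S R → Instance i↓ (S ⟨ 𝗍 ⟩) (S ⟨ R ∨ neg R ⟩)
    i↑ : ∀ S R → Instance i↑ (S ⟨ R ∧ neg R ⟩) (S ⟨ 𝖿 ⟩)
    s  : ∀ S R T U → Instance s (S ⟨ (R ∨ U) ∧ T ⟩) (S ⟨ (R ∧ T) ∨ U ⟩)
    w↓ : ∀ S R → Instance w↓ (S ⟨ 𝖿 ⟩) (S ⟨ R ⟩)
    w↑ : ∀ S R → Instance w↑ (S ⟨ R ⟩) (S ⟨ 𝗍 ⟩)
    c↓ : ∀ S R → Instance c↓ (S ⟨ R ∨ R ⟩) (S ⟨ R ⟩)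
    c↑ : ∀ S R → Instance c↑ (S ⟨ R ⟩) (S ⟨ R ∧ R ⟩)
    u↓ : ∀ S x R T → Instance u↓ (S ⟨ all x (R ∨ T) ⟩) (S ⟨ all x R ∨ ex x T ⟩)
    u↑ : ∀ S x R T → Instance u↑ (S ⟨ ex x R ∧ all x T ⟩) (S ⟨ ex x (R ∧ T) ⟩)
    n↓ : ∀ S x t R → FreeFor t x R → Instance n↓ (S ⟨ R [ x / t ] ⟩) (S ⟨ ex x R ⟩)
    n↑ : ∀ S x t R → FreeFor t x R → Instance n↑ (S ⟨ all x R ⟩) (S ⟨ R [ x / t ] ⟩)

  -- Equivalent structures are identified, so any two representatives of the same
  -- structure may be exchanged at the ends of a derivation and between instances.
  data Derivation (𝒮 : System) (P : Structure) : Structure → Set where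
    single : ∀ {C} → P ≈ C → Derivation 𝒮 P C
    extend : ∀ {ρ Q Q′ C′ C} → Derivation 𝒮 P Q → Q ≈ Q′ →
             ρ ∈ 𝒮 → Instance ρ Q′ C′ → C′ ≈ C → Derivation 𝒮 P C

  Proof : System → Structure → Set
  Proof 𝒮 R = Derivation 𝒮 𝗍 R

  Admissible : Rule → System → Set
  Admissible ρ 𝒮 = ∀ R → Proof (𝒮 ∪ ｛ ρ ｝) R → Proof 𝒮 R

-- Call Γ and Δ orthogonal if Γ ∨ Δ is provable in KSgq, and interpret structures
-- as sets of structures closed under double orthogonality, with conjunction and ∀
-- as intersections and negation as the orthogonal.  Weakening and contraction make
-- these sets a Boolean algebra, so every rule is sound, the up-rules included.
-- Conversely, by induction on R, every Γ in the interpretation of R is orthogonal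
-- to R.  Hence from any proof of R the unit 𝖿 lies in the interpretation of R, so
-- 𝖿 ∨ R, which is R, is provable in KSgq.

{-# OPTIONS --safe #-}
module Submission where

open import Defs
open import Data.Bool using (if_then_else_)
open import Data.Empty using (⊥-elim)
open import Data.List using (List; []; _∷_; _++_)
open import Data.List.NonEmpty using (_∷_; toList; _++⁺_)
open import Data.List.Properties using (++-identityʳ)
open import Data.List.Relation.Unary.All using (All; []; _∷_)
open import Data.List.Relation.Unary.Any as Anyˡ using (here; there) renaming (Any to Anyˡ)
open import Data.Nat using (ℕ; suc; _≟_; _≤_; _<_; _⊔_; s≤s)
open import Data.Nat.Properties
  using (≤-refl; ≤-trans; <-≤-trans; <-irrefl; n≤1+n; m≤m⊔n; m≤n⊔m; <⇒≢; <⇒≤; m≤n⇒m≤1+n)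
open import Data.Product using (∃; _×_; _,_; proj₁; proj₂)
open import Data.Sign using (Sign)
open import Data.Sum using (inj₁; inj₂)
open import Data.Unit using (tt)
open import Data.Vec using (Vec; []; _∷_)
open import Data.Vec.Relation.Unary.Any as Anyᵛ using (here; there) renaming (Any to Anyᵛ)
open import Function using (_∘_)
open import Level using (0ℓ)
open import Relation.Binary.PropositionalEquality
  using (_≡_; _≢_; refl; sym; trans; cong; cong₂; subst; subst₂)
open import Relation.Nullary using (Dec; ¬_; yes; no; does)
open import Relation.Nullary.Decidable using (dec-true; dec-false)
open import Relation.Unary using (Pred; _∈_; _∩_; _∪_; U; ⋂; _⊆′_; _≐′_)
open import Relation.Unary.Properties using (≐′-refl; ≐′-sym; ≐′-trans)

-- The overview leaves variable binding aside, and binding shapes most of the proof. Substitution in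
-- the calculus never renames, so it is usable only under `FreeFor`. The interpretation therefore
-- evaluates a structure in an environment and lets quantifiers range over all terms, and the
-- induction on R needs a structure `sub k ρ R` that represents R in `ρ`. Its binders are numbered
-- from a level `k` above all variables that `ρ` supplies to R, which turns freshness into an
-- inequality; the syntactic work is to show that the choice of `k` does not matter up to renaming.
-- Negation is a constructor and the orthogonal reverses inclusions, so the induction treats R and
-- `neg R` together. For a universal quantifier, a variable fresh for Γ is among the terms ranged
-- over and acts as eigenvariable; for an existential one, each term ranged over is a possible
-- witness of `n↓`. Contraction is where cut disappears: a Γ in both X and its orthogonal makes Γ ∨
-- Γ provable, hence Γ.

module _ (𝓛 : Signature) where

  open Signature 𝓛
  open Calculus 𝓛

  -- Environments and simultaneous substitution

  Env : Set
  Env = Variable → Term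

  infixl 9 _[_≔_]

  _[_≔_] : Env → Variable → Term → Env
  (ρ [ x ≔ t ]) y = if does (x ≟ y) then t else ρ y

  update-≡ : ∀ ρ x t → (ρ [ x ≔ t ]) x ≡ t
  update-≡ ρ x t = cong (if_then t else ρ x) (dec-true (x ≟ x) refl)

  update-≢ : ∀ ρ {x y} t → x ≢ y → (ρ [ x ≔ t ]) y ≡ ρ y
  update-≢ ρ {x} {y} t x≢y = cong (if_then t else ρ y) (dec-false (x ≟ y) x≢y)

  update-cong : ∀ {P : Pred Variable 0ℓ} {ρ σ} x {t u} → t ≡ u →
                (∀ {y} → x ≢ y → y ∈ P → ρ y ≡ σ y) →
                ∀ {y} → y ∈ P → (ρ [ x ≔ t ]) y ≡ (σ [ x ≔ u ]) y
  update-cong {ρ = ρ} {σ} x {t} refl eq {y} y∈P with x ≟ y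
  ... | yes refl = trans (update-≡ ρ x t) (sym (update-≡ σ x t))
  ... | no x≢y   = trans (update-≢ ρ t x≢y) (trans (eq x≢y y∈P) (sym (update-≢ σ t x≢y)))

  update-var : ∀ x y → (var [ x ≔ var x ]) y ≡ var y
  update-var x y with x ≟ y
  ... | yes refl = update-≡ var x (var x)
  ... | no x≢y   = update-≢ var (var x) x≢y

  update-comm : ∀ ρ {x y} t u → x ≢ y → ∀ z →
                (ρ [ y ≔ u ] [ x ≔ t ]) z ≡ (ρ [ x ≔ t ] [ y ≔ u ]) z
  update-comm ρ {x} {y} t u x≢y z with x ≟ z | y ≟ z
  ... | yes refl | yes refl = ⊥-elim (x≢y refl)
  ... | yes refl | no y≢z   =
    trans (update-≡ (ρ [ y ≔ u ]) x t) (sym (trans (update-≢ (ρ [ x ≔ t ]) u y≢z) (update-≡ ρ x t)))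
  ... | no x≢z   | yes refl =
    trans (trans (update-≢ (ρ [ y ≔ u ]) t x≢z) (update-≡ ρ y u)) (sym (update-≡ (ρ [ x ≔ t ]) y u))
  ... | no x≢z   | no y≢z   =
    trans (trans (update-≢ (ρ [ y ≔ u ]) t x≢z) (update-≢ ρ u y≢z))
          (sym (trans (update-≢ (ρ [ x ≔ t ]) u y≢z) (update-≢ ρ t x≢z)))

  mutual
    tsub : Env → Term → Term
    tsub ρ (var x)    = ρ x
    tsub ρ (fun f ts) = fun f (tsubs ρ ts)

    tsubs : ∀ {n} → Env → Vec Term n → Vec Term n
    tsubs ρ []       = []
    tsubs ρ (t ∷ ts) = tsub ρ t ∷ tsubs ρ ts

  mutual
    tsub-cong : ∀ {ρ σ} t → (∀ {y} → y OccursIn t → ρ y ≡ σ y) → tsub ρ t ≡ tsub σ t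
    tsub-cong (var x)    eq = eq var
    tsub-cong (fun f ts) eq = cong (fun f) (tsubs-cong ts (λ i → eq (fun i)))

    tsubs-cong : ∀ {n ρ σ} (ts : Vec Term n) → (∀ {y} → Anyᵛ (y OccursIn_) ts → ρ y ≡ σ y) →
                 tsubs ρ ts ≡ tsubs σ ts
    tsubs-cong []       eq = refl
    tsubs-cong (t ∷ ts) eq = cong₂ _∷_ (tsub-cong t (λ i → eq (here i))) (tsubs-cong ts (λ i → eq (there i)))

  mutual
    tsub-∘ : ∀ σ ρ t → tsub σ (tsub ρ t) ≡ tsub (tsub σ ∘ ρ) t
    tsub-∘ σ ρ (var x)    = refl
    tsub-∘ σ ρ (fun f ts) = cong (fun f) (tsubs-∘ σ ρ ts)

    tsubs-∘ : ∀ {n} σ ρ (ts : Vec Term n) → tsubs σ (tsubs ρ ts) ≡ tsubs (tsub σ ∘ ρ) ts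
    tsubs-∘ σ ρ []       = refl
    tsubs-∘ σ ρ (t ∷ ts) = cong₂ _∷_ (tsub-∘ σ ρ t) (tsubs-∘ σ ρ ts)

  mutual
    tsub-id : ∀ t → tsub var t ≡ t
    tsub-id (var x)    = refl
    tsub-id (fun f ts) = cong (fun f) (tsubs-id ts)

    tsubs-id : ∀ {n} (ts : Vec Term n) → tsubs var ts ≡ ts
    tsubs-id []       = refl
    tsubs-id (t ∷ ts) = cong₂ _∷_ (tsub-id t) (tsubs-id ts)

  mutual
    substTerm-tsub : ∀ x t u → substTerm x t u ≡ tsub (var [ x ≔ t ]) u
    substTerm-tsub x t (var y)    = refl
    substTerm-tsub x t (fun f us) = cong (fun f) (substTerms-tsubs x t us)

    substTerms-tsubs : ∀ {n} x t (us : Vec Term n) → substTerms x t us ≡ tsubs (var [ x ≔ t ]) us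
    substTerms-tsubs x t []       = refl
    substTerms-tsubs x t (u ∷ us) = cong₂ _∷_ (substTerm-tsub x t u) (substTerms-tsubs x t us)

  tsub-update : ∀ ρ x t y → tsub ρ ((var [ x ≔ t ]) y) ≡ (ρ [ x ≔ tsub ρ t ]) y
  tsub-update ρ x t y with x ≟ y
  ... | yes refl = trans (cong (tsub ρ) (update-≡ var x t)) (sym (update-≡ ρ x (tsub ρ t)))
  ... | no x≢y   = trans (cong (tsub ρ) (update-≢ var t x≢y)) (sym (update-≢ ρ (tsub ρ t) x≢y))

  tsubs-substTerms : ∀ {n} ρ x t (us : Vec Term n) →
                     tsubs ρ (substTerms x t us) ≡ tsubs (ρ [ x ≔ tsub ρ t ]) us
  tsubs-substTerms ρ x t us =
    trans (cong (tsubs ρ) (substTerms-tsubs x t us))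
      (trans (tsubs-∘ ρ (var [ x ≔ t ]) us) (tsubs-cong us (λ {y} i → tsub-update ρ x t y)))

  substTerms-tsubs-∘ : ∀ {n} x t ρ (us : Vec Term n) →
                       substTerms x t (tsubs ρ us) ≡ tsubs (substTerm x t ∘ ρ) us
  substTerms-tsubs-∘ x t ρ us =
    trans (substTerms-tsubs x t _)
      (trans (tsubs-∘ (var [ x ≔ t ]) ρ us) (tsubs-cong us (λ {y} _ → sym (substTerm-tsub x t (ρ y)))))

  tsub-update-fresh : ∀ ρ x t u → ¬ x OccursIn u → tsub (ρ [ x ≔ t ]) u ≡ tsub ρ u
  tsub-update-fresh ρ x t u x∉u =
    tsub-cong u λ y∈u → update-≢ ρ {x} t λ { refl → x∉u y∈u }

  substTerm-fresh : ∀ x t u → ¬ x OccursIn u → substTerm x t u ≡ u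
  substTerm-fresh x t u x∉u =
    trans (substTerm-tsub x t u) (trans (tsub-update-fresh var x t u x∉u) (tsub-id u))

  mutual
    tsub-occurs : ∀ ρ t {y} → y OccursIn tsub ρ t → ∃ λ z → z OccursIn t × y OccursIn ρ z
    tsub-occurs ρ (var x)    y∈       = x , var , y∈
    tsub-occurs ρ (fun f ts) (fun y∈) = let z , z∈ , y∈′ = tsubs-occurs ρ ts y∈ in z , fun z∈ , y∈′

    tsubs-occurs : ∀ {n} ρ (ts : Vec Term n) {y} → Anyᵛ (y OccursIn_) (tsubs ρ ts) →
                   ∃ λ z → Anyᵛ (z OccursIn_) ts × y OccursIn ρ z
    tsubs-occurs ρ (t ∷ ts) (here y∈)  = let z , z∈ , y∈′ = tsub-occurs ρ t y∈ in z , here z∈ , y∈′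
    tsubs-occurs ρ (t ∷ ts) (there y∈) = let z , z∈ , y∈′ = tsubs-occurs ρ ts y∈ in z , there z∈ , y∈′

  -- Upper bounds for variables

  Below : ℕ → Term → Set
  Below k t = ∀ {y} → y OccursIn t → y < k

  Below-≤ : ∀ {k m} t → k ≤ m → Below k t → Below m t
  Below-≤ t k≤m b y∈ = <-≤-trans (b y∈) k≤m

  Below-var : ∀ k → Below (suc k) (var k)
  Below-var k var = ≤-refl

  Fresh : ∀ {k t} → Below k t → ¬ k OccursIn t
  Fresh b k∈ = <-irrefl refl (b k∈)

  BelowEnv : ℕ → Env → Structure → Set
  BelowEnv k ρ A = ∀ {z} → z FreeIn A → Below k (ρ z)

  Bounded : Pred Variable 0ℓ → Set
  Bounded P = ∃ λ k → ∀ {y} → y ∈ P → y < k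

  bounded-⊆ : ∀ {P Q} → (∀ {y} → y ∈ Q → y ∈ P) → Bounded P → Bounded Q
  bounded-⊆ Q⊆P (k , b) = k , λ y∈Q → b (Q⊆P y∈Q)

  bounded-∪ : ∀ {P Q} → Bounded P → Bounded Q → Bounded (P ∪ Q)
  bounded-∪ (k , b) (l , c) =
    k ⊔ l , λ { (inj₁ y∈) → <-≤-trans (b y∈) (m≤m⊔n k l)
              ; (inj₂ y∈) → <-≤-trans (c y∈) (m≤n⊔m k l) }

  mutual
    boundTerm : ∀ t → Bounded (_OccursIn t)
    boundTerm (var x)    = suc x , Below-var x
    boundTerm (fun f ts) = bounded-⊆ (λ { (fun y∈) → y∈ }) (boundTerms ts)

    boundTerms : ∀ {n} (ts : Vec Term n) → Bounded (λ y → Anyᵛ (y OccursIn_) ts)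
    boundTerms []       = 0 , λ ()
    boundTerms (t ∷ ts) = bounded-⊆ Anyᵛ.toSum (bounded-∪ (boundTerm t) (boundTerms ts))

  mutual
    boundStructure : ∀ A → Bounded (_FreeIn A)
    boundStructure 𝖿        = 0 , λ ()
    boundStructure 𝗍        = 0 , λ ()
    boundStructure (atom a) = bounded-⊆ (λ { (atom y∈) → y∈ }) (boundTerms (Atom.arguments a))
    boundStructure (disj (R ∷ Rs)) =
      bounded-⊆ (λ { (disj y∈) → Anyˡ.toSum y∈ }) (bounded-∪ (boundStructure R) (boundList Rs))
    boundStructure (conj (R ∷ Rs)) =
      bounded-⊆ (λ { (conj y∈) → Anyˡ.toSum y∈ }) (bounded-∪ (boundStructure R) (boundList Rs))
    boundStructure (neg R)   = bounded-⊆ (λ { (neg y∈) → y∈ }) (boundStructure R)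
    boundStructure (ex x R)  = bounded-⊆ (λ { (ex _ y∈) → y∈ }) (boundStructure R)
    boundStructure (all x R) = bounded-⊆ (λ { (all _ y∈) → y∈ }) (boundStructure R)

    boundList : ∀ Rs → Bounded (λ y → Anyˡ (y FreeIn_) Rs)
    boundList []       = 0 , λ ()
    boundList (R ∷ Rs) = bounded-⊆ Anyˡ.toSum (bounded-∪ (boundStructure R) (boundList Rs))

  -- Capture-avoiding substitution

  data Quantifier : Set where
    ∃′ ∀′ : Quantifier

  quant : Quantifier → Variable → Structure → Structure
  quant ∃′ = ex
  quant ∀′ = all

  -- Bound variables become de Bruijn levels k, k+1, …; no variable is captured
  -- as soon as all variables introduced by ρ are below k.
  mutual
    sub : ℕ → Env → Structure → Structure
    sub k ρ 𝖿               = 𝖿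
    sub k ρ 𝗍               = 𝗍
    sub k ρ (atom a)        = atom (record a { arguments = tsubs ρ (Atom.arguments a) })
    sub k ρ (disj (R ∷ Rs)) = disj (sub k ρ R ∷ subList k ρ Rs)
    sub k ρ (conj (R ∷ Rs)) = conj (sub k ρ R ∷ subList k ρ Rs)
    sub k ρ (neg R)         = neg (sub k ρ R)
    sub k ρ (ex x R)        = ex k (sub (suc k) (ρ [ x ≔ var k ]) R)
    sub k ρ (all x R)       = all k (sub (suc k) (ρ [ x ≔ var k ]) R)

    subList : ℕ → Env → List Structure → List Structure
    subList k ρ []       = []
    subList k ρ (R ∷ Rs) = sub k ρ R ∷ subList k ρ Rs

  mutual
    sub-cong : ∀ k {ρ σ} A → (∀ {z} → z FreeIn A → ρ z ≡ σ z) → sub k ρ A ≡ sub k σ A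
    sub-cong k 𝖿               eq = refl
    sub-cong k 𝗍               eq = refl
    sub-cong k (atom (mkAtom ± p ts)) eq =
      cong (atom ∘ mkAtom ± p) (tsubs-cong ts (λ i → eq (atom i)))
    sub-cong k (disj (R ∷ Rs)) eq =
      cong₂ (λ T Ts → disj (T ∷ Ts))
        (sub-cong k R (λ i → eq (disj (here i))))
        (subList-cong k Rs (λ i → eq (disj (there i))))
    sub-cong k (conj (R ∷ Rs)) eq =
      cong₂ (λ T Ts → conj (T ∷ Ts))
        (sub-cong k R (λ i → eq (conj (here i))))
        (subList-cong k Rs (λ i → eq (conj (there i))))
    sub-cong k (neg R)         eq = cong neg (sub-cong k R (λ i → eq (neg i)))
    sub-cong k (ex x R)        eq =
      cong (ex k) (sub-cong (suc k) R (update-cong x refl λ x≢z i → eq (ex (x≢z ∘ sym) i)))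
    sub-cong k (all x R)       eq =
      cong (all k) (sub-cong (suc k) R (update-cong x refl λ x≢z i → eq (all (x≢z ∘ sym) i)))

    subList-cong : ∀ k {ρ σ} Rs → (∀ {z} → Anyˡ (z FreeIn_) Rs → ρ z ≡ σ z) →
                   subList k ρ Rs ≡ subList k σ Rs
    subList-cong k []       eq = refl
    subList-cong k (R ∷ Rs) eq =
      cong₂ _∷_ (sub-cong k R (λ i → eq (here i))) (subList-cong k Rs (λ i → eq (there i)))

  substTerm-update : ∀ ρ {k m} x t → k < m → ∀ z →
                     substTerm k t ((ρ [ x ≔ var m ]) z) ≡ ((substTerm k t ∘ ρ) [ x ≔ var m ]) z
  substTerm-update ρ {k} {m} x t k<m z with x ≟ z
  ... | yes refl = trans (cong (substTerm k t) (update-≡ ρ x (var m)))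
                     (trans (update-≢ var t (<⇒≢ k<m)) (sym (update-≡ (substTerm k t ∘ ρ) x (var m))))
  ... | no x≢z   = trans (cong (substTerm k t) (update-≢ ρ (var m) x≢z))
                     (sym (update-≢ (substTerm k t ∘ ρ) (var m) x≢z))

  mutual
    -- Every binder of `sub m ρ A` is at least `m`, so `k` is nowhere bound. Variables of `t` may be
    -- captured, but both sides put `t` under the same binders and so agree literally.
    sub-subst : ∀ {k m} ρ A t → k < m →
                (sub m ρ A) [ k / t ] ≡ sub m (substTerm k t ∘ ρ) A
    sub-subst ρ 𝖿               t k<m = refl
    sub-subst ρ 𝗍               t k<m = refl
    sub-subst ρ (atom (mkAtom ± p ts)) t k<m =
      cong (atom ∘ mkAtom ± p) (substTerms-tsubs-∘ _ t ρ ts)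
    sub-subst ρ (disj (R ∷ Rs)) t k<m =
      cong₂ (λ T Ts → disj (T ∷ Ts)) (sub-subst ρ R t k<m) (subList-subst ρ Rs t k<m)
    sub-subst ρ (conj (R ∷ Rs)) t k<m =
      cong₂ (λ T Ts → conj (T ∷ Ts)) (sub-subst ρ R t k<m) (subList-subst ρ Rs t k<m)
    sub-subst ρ (neg R)         t k<m = cong neg (sub-subst ρ R t k<m)
    sub-subst {m = m} ρ (ex x R)  t k<m = cong (ex m) (sub-subst-body ρ x R t k<m)
    sub-subst {m = m} ρ (all x R) t k<m = cong (all m) (sub-subst-body ρ x R t k<m)

    sub-subst-body : ∀ {k m} ρ x A t → k < m →
      let B = sub (suc m) (ρ [ x ≔ var m ]) A in
      (if does (k ≟ m) then B else B [ k / t ]) ≡ sub (suc m) ((substTerm k t ∘ ρ) [ x ≔ var m ]) A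
    sub-subst-body {k} {m} ρ x A t k<m =
      let B = sub (suc m) (ρ [ x ≔ var m ]) A in
      trans (cong (if_then B else B [ k / t ]) (dec-false (k ≟ m) (<⇒≢ k<m)))
        (trans (sub-subst (ρ [ x ≔ var m ]) A t (≤-trans k<m (n≤1+n m)))
          (sub-cong (suc m) A λ {z} _ → substTerm-update ρ x t k<m z))

    subList-subst : ∀ {k m} ρ Rs t → k < m →
                    substList k t (subList m ρ Rs) ≡ subList m (substTerm k t ∘ ρ) Rs
    subList-subst ρ []       t k<m = refl
    subList-subst ρ (R ∷ Rs) t k<m = cong₂ _∷_ (sub-subst ρ R t k<m) (subList-subst ρ Rs t k<m)

  mutual
    -- Binders start at `m` and the variables of `t` lie below it, so nothing is captured, whatever
    -- `ρ` is.
    sub-freeFor : ∀ {k m t} ρ A → Below m t → FreeFor t k (sub m ρ A)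
    sub-freeFor ρ 𝖿               b = 𝖿
    sub-freeFor ρ 𝗍               b = 𝗍
    sub-freeFor ρ (atom a)        b = atom
    sub-freeFor ρ (disj (R ∷ Rs)) b = disj (sub-freeFor ρ R b ∷ subList-freeFor ρ Rs b)
    sub-freeFor ρ (conj (R ∷ Rs)) b = conj (sub-freeFor ρ R b ∷ subList-freeFor ρ Rs b)
    sub-freeFor ρ (neg R)         b = neg (sub-freeFor ρ R b)
    sub-freeFor {t = t} ρ (ex x R)  b =
      ex-noClash (Fresh {t = t} b) (sub-freeFor (ρ [ x ≔ var _ ]) R (Below-≤ t (n≤1+n _) b))
    sub-freeFor {t = t} ρ (all x R) b =
      all-noClash (Fresh {t = t} b) (sub-freeFor (ρ [ x ≔ var _ ]) R (Below-≤ t (n≤1+n _) b))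

    subList-freeFor : ∀ {k m t} ρ Rs → Below m t → All (FreeFor t k) (subList m ρ Rs)
    subList-freeFor ρ []       b = []
    subList-freeFor ρ (R ∷ Rs) b = sub-freeFor ρ R b ∷ subList-freeFor ρ Rs b

  mutual
    sub-free : ∀ k ρ A {y} → y FreeIn sub k ρ A → ∃ λ z → z FreeIn A × y OccursIn ρ z
    sub-free k ρ (atom a) (atom y∈) =
      let z , z∈ , y∈′ = tsubs-occurs ρ (Atom.arguments a) y∈ in z , atom z∈ , y∈′
    sub-free k ρ (disj (R ∷ Rs)) (disj y∈) =
      let z , z∈ , y∈′ = subList-free k ρ (R ∷ Rs) y∈ in z , disj z∈ , y∈′
    sub-free k ρ (conj (R ∷ Rs)) (conj y∈) =
      let z , z∈ , y∈′ = subList-free k ρ (R ∷ Rs) y∈ in z , conj z∈ , y∈′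
    sub-free k ρ (neg R) (neg y∈) = let z , z∈ , y∈′ = sub-free k ρ R y∈ in z , neg z∈ , y∈′
    sub-free k ρ (ex x R) (ex y≢k y∈) =
      let z , x≢z , z∈ , y∈′ = sub-free-body k ρ x R y≢k y∈ in z , ex (x≢z ∘ sym) z∈ , y∈′
    sub-free k ρ (all x R) (all y≢k y∈) =
      let z , x≢z , z∈ , y∈′ = sub-free-body k ρ x R y≢k y∈ in z , all (x≢z ∘ sym) z∈ , y∈′

    sub-free-body : ∀ k ρ x A {y} → y ≢ k → y FreeIn sub (suc k) (ρ [ x ≔ var k ]) A →
                    ∃ λ z → x ≢ z × z FreeIn A × y OccursIn ρ z
    sub-free-body k ρ x A {y} y≢k y∈ with sub-free (suc k) (ρ [ x ≔ var k ]) A y∈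
    ... | z , z∈ , y∈′ with x ≟ z
    ...   | no x≢z   = z , x≢z , z∈ , subst (y OccursIn_) (update-≢ ρ (var k) x≢z) y∈′
    ...   | yes refl with subst (y OccursIn_) (update-≡ ρ x (var k)) y∈′
    ...     | var = ⊥-elim (y≢k refl)

    subList-free : ∀ k ρ Rs {y} → Anyˡ (y FreeIn_) (subList k ρ Rs) →
                   ∃ λ z → Anyˡ (z FreeIn_) Rs × y OccursIn ρ z
    subList-free k ρ (R ∷ Rs) (here y∈)  = let z , z∈ , y∈′ = sub-free k ρ R y∈ in z , here z∈ , y∈′
    subList-free k ρ (R ∷ Rs) (there y∈) = let z , z∈ , y∈′ = subList-free k ρ Rs y∈ in z , there z∈ , y∈′

  -- Equivalence of structures

  ≡⇒≈ : ∀ {R T} → R ≡ T → R ≈ T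
  ≡⇒≈ refl = ≈-refl

  ∨-congˡ : ∀ {R R′} T → R ≈ R′ → R ∨ T ≈ R′ ∨ T
  ∨-congˡ T = ctx-cong (disj [] hole (T ∷ []))

  ∨-congʳ : ∀ R {T T′} → T ≈ T′ → R ∨ T ≈ R ∨ T′
  ∨-congʳ R = ctx-cong (disj (R ∷ []) hole [])

  ∨-cong : ∀ {R R′ T T′} → R ≈ R′ → T ≈ T′ → R ∨ T ≈ R′ ∨ T′
  ∨-cong e f = ≈-trans (∨-congˡ _ e) (∨-congʳ _ f)

  ∧-congˡ : ∀ {R R′} T → R ≈ R′ → R ∧ T ≈ R′ ∧ T
  ∧-congˡ T = ctx-cong (conj [] hole (T ∷ []))

  ∧-cong : ∀ {R R′ T T′} → R ≈ R′ → T ≈ T′ → R ∧ T ≈ R′ ∧ T′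
  ∧-cong {R′ = R′} e f = ≈-trans (∧-congˡ _ e) (ctx-cong (conj (R′ ∷ []) hole []) f)

  quant-cong : ∀ q x {R T} → R ≈ T → quant q x R ≈ quant q x T
  quant-cong ∃′ x = ctx-cong (ex x hole)
  quant-cong ∀′ x = ctx-cong (all x hole)

  quant-rename : ∀ q {x y R} → ¬ y FreeIn R → FreeFor (var y) x R →
                 quant q x R ≈ quant q y (R [ x / var y ])
  quant-rename ∃′ = ex-rename
  quant-rename ∀′ = all-rename

  ∨-assoc : ∀ R T U → (R ∨ T) ∨ U ≈ R ∨ (T ∨ U)
  ∨-assoc R T U = ≈-trans (disj-assoc [] (R ∷ T ∷ []) (U ∷ []))
                    (≈-sym (disj-assoc (R ∷ []) (T ∷ U ∷ []) []))

  ∨𝖿 : ∀ R → R ∨ 𝖿 ≈ R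
  ∨𝖿 R = ≈-trans (disj-comm R 𝖿) (𝖿∨ R)

  ∧𝗍 : ∀ R → R ∧ 𝗍 ≈ R
  ∧𝗍 R = ≈-trans (conj-comm R 𝗍) (𝗍∧ R)

  -- The tail of a non-empty list may be empty; letting it denote the unit reduces lists to the
  -- binary connectives.
  ⋁ ⋀ : List Structure → Structure
  ⋁ []       = 𝖿
  ⋁ (R ∷ Rs) = disj (R ∷ Rs)
  ⋀ []       = 𝗍
  ⋀ (R ∷ Rs) = conj (R ∷ Rs)

  disj-∷ : ∀ R Rs → disj (R ∷ Rs) ≈ R ∨ ⋁ Rs
  -- No law rewrites [R] to R directly: the singleton is flattened inside a disjunction with 𝖿.
  disj-∷ R []       = ≈-trans (≈-sym (𝖿∨ _)) (≈-trans (disj-assoc (𝖿 ∷ []) (R ∷ []) []) (disj-comm 𝖿 R))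
  disj-∷ R (T ∷ Rs) = ≈-sym (≈-trans (disj-assoc (R ∷ []) (T ∷ Rs) [])
                                (≡⇒≈ (cong (λ Ts → disj (R ∷ T ∷ Ts)) (++-identityʳ Rs))))

  conj-∷ : ∀ R Rs → conj (R ∷ Rs) ≈ R ∧ ⋀ Rs
  conj-∷ R []       = ≈-trans (≈-sym (𝗍∧ _)) (≈-trans (conj-assoc (𝗍 ∷ []) (R ∷ []) []) (conj-comm 𝗍 R))
  conj-∷ R (T ∷ Rs) = ≈-sym (≈-trans (conj-assoc (R ∷ []) (T ∷ Rs) [])
                                (≡⇒≈ (cong (λ Ts → conj (R ∷ T ∷ Ts)) (++-identityʳ Rs))))

  ⋁-cong : ∀ {R T} Rs Ts → R ≈ T → ⋁ Rs ≈ ⋁ Ts → disj (R ∷ Rs) ≈ disj (T ∷ Ts)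
  ⋁-cong Rs Ts e f = ≈-trans (disj-∷ _ Rs) (≈-trans (∨-cong e f) (≈-sym (disj-∷ _ Ts)))

  ⋀-cong : ∀ {R T} Rs Ts → R ≈ T → ⋀ Rs ≈ ⋀ Ts → conj (R ∷ Rs) ≈ conj (T ∷ Ts)
  ⋀-cong Rs Ts e f = ≈-trans (conj-∷ _ Rs) (≈-trans (∧-cong e f) (≈-sym (conj-∷ _ Ts)))

  -- Renaming of bound variables

  -- The variable `k` is a placeholder: it enters only as the value of `x`, and the binders from `m`
  -- on leave it free.
  sub-instantiate : ∀ {k m} ρ x A t → k < m → (∀ {z} → x ≢ z → z FreeIn A → ¬ k OccursIn ρ z) →
                    (sub m (ρ [ x ≔ var k ]) A) [ k / t ] ≡ sub m (ρ [ x ≔ t ]) A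
  sub-instantiate {k} {m} ρ x A t k<m k∉ρ =
    trans (sub-subst (ρ [ x ≔ var k ]) A t k<m) (sub-cong m A agree)
    where
    agree : ∀ {z} → z FreeIn A → substTerm k t ((ρ [ x ≔ var k ]) z) ≡ (ρ [ x ≔ t ]) z
    agree {z} z∈ with x ≟ z
    ... | yes refl = trans (cong (substTerm k t) (update-≡ ρ x (var k)))
                       (trans (update-≡ var k t) (sym (update-≡ ρ x t)))
    ... | no x≢z   = trans (cong (substTerm k t) (update-≢ ρ (var k) x≢z))
                       (trans (substTerm-fresh k t (ρ z) (k∉ρ x≢z z∈)) (sym (update-≢ ρ t x≢z)))

  sub-rename : ∀ q {k l m} ρ x A → k < m → l < m →
               (∀ {z} → x ≢ z → z FreeIn A → ¬ k OccursIn ρ z) →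
               (∀ {z} → x ≢ z → z FreeIn A → ¬ l OccursIn ρ z) →
               quant q k (sub m (ρ [ x ≔ var k ]) A) ≈ quant q l (sub m (ρ [ x ≔ var l ]) A)
  sub-rename q {k} {l} {m} ρ x A k<m l<m k∉ρ l∉ρ with k ≟ l
  -- Renaming a variable to itself may violate the side condition of the renaming law, since it can
  -- be free in the body.
  ... | yes refl = ≈-refl
  ... | no k≢l   =
    ≈-trans (quant-rename q l∉ (sub-freeFor (ρ [ x ≔ var k ]) A λ { var → l<m }))
      (≡⇒≈ (cong (quant q l) (sub-instantiate ρ x A (var l) k<m k∉ρ)))
    where
    l∉ : ¬ l FreeIn sub m (ρ [ x ≔ var k ]) A
    l∉ l∈ with sub-free m (ρ [ x ≔ var k ]) A l∈
    ... | z , z∈ , l∈ρz with x ≟ z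
    ...   | no x≢z   = l∉ρ x≢z z∈ (subst (l OccursIn_) (update-≢ ρ (var k) x≢z) l∈ρz)
    ...   | yes refl with subst (l OccursIn_) (update-≡ ρ x (var k)) l∈ρz
    ...     | var = k≢l refl

  BelowBody : ℕ → Env → Variable → Structure → Set
  BelowBody k ρ x A = ∀ {z} → x ≢ z → z FreeIn A → Below k (ρ z)

  BelowBody-ex : ∀ {k ρ x A} → BelowEnv k ρ (ex x A) → BelowBody k ρ x A
  BelowBody-ex b x≢z z∈ = b (ex (x≢z ∘ sym) z∈)

  BelowBody-all : ∀ {k ρ x A} → BelowEnv k ρ (all x A) → BelowBody k ρ x A
  BelowBody-all b x≢z z∈ = b (all (x≢z ∘ sym) z∈)

  BelowBody-fresh : ∀ {k ρ x A} → BelowBody k ρ x A → ∀ {z} → x ≢ z → z FreeIn A → ¬ k OccursIn ρ z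
  BelowBody-fresh b x≢z z∈ k∈ = <-irrefl refl (b x≢z z∈ k∈)

  BelowBody-≤ : ∀ {k l ρ x A} → k ≤ l → BelowBody k ρ x A → BelowBody l ρ x A
  BelowBody-≤ {ρ = ρ} k≤l b {z} x≢z z∈ = Below-≤ (ρ z) k≤l (b x≢z z∈)

  BelowEnv-update : ∀ {k m} ρ x A {t} → k ≤ m → BelowBody k ρ x A → Below m t →
                    BelowEnv m (ρ [ x ≔ t ]) A
  BelowEnv-update {m = m} ρ x A {t} k≤m b c {z} z∈ with x ≟ z
  ... | yes refl = subst (Below m) (sym (update-≡ ρ x t)) c
  ... | no x≢z   = subst (Below m) (sym (update-≢ ρ t x≢z)) (Below-≤ (ρ z) k≤m (b x≢z z∈))

  -- At a level above both `k` and the variables of `t`, the instance by `t` is a literal,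
  -- capture-free substitution, the form in which `n↓` takes it.
  instantiate-above : ∀ {k} ρ x A t → BelowBody k ρ x A → ∃ λ m → k < m × Below m t ×
                      sub m (ρ [ x ≔ t ]) A ≡ (sub m (ρ [ x ≔ var k ]) A) [ k / t ]
  instantiate-above {k} ρ x A t b =
    let l , c = boundTerm t
        k<m   = s≤s (m≤m⊔n k l)
    in suc (k ⊔ l) , k<m , Below-≤ t (≤-trans (m≤n⊔m k l) (n≤1+n _)) c ,
       sym (sub-instantiate ρ x A t k<m (BelowBody-fresh {ρ = ρ} b))

  mutual
    sub-level : ∀ {k l} ρ A → BelowEnv k ρ A → BelowEnv l ρ A → sub k ρ A ≈ sub l ρ A
    sub-level ρ 𝖿        b c = ≈-refl
    sub-level ρ 𝗍        b c = ≈-refl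
    sub-level ρ (atom a) b c = ≈-refl
    sub-level ρ (disj (R ∷ Rs)) b c =
      ⋁-cong (subList _ ρ Rs) (subList _ ρ Rs)
        (sub-level ρ R (λ i → b (disj (here i))) (λ i → c (disj (here i))))
        (⋁-level ρ Rs (λ i → b (disj (there i))) (λ i → c (disj (there i))))
    sub-level ρ (conj (R ∷ Rs)) b c =
      ⋀-cong (subList _ ρ Rs) (subList _ ρ Rs)
        (sub-level ρ R (λ i → b (conj (here i))) (λ i → c (conj (here i))))
        (⋀-level ρ Rs (λ i → b (conj (there i))) (λ i → c (conj (there i))))
    sub-level ρ (neg R)   b c = neg-cong (sub-level ρ R (λ i → b (neg i)) (λ i → c (neg i)))
    sub-level ρ (ex x R)  b c = quant-level ∃′ ρ x R (BelowBody-ex b) (BelowBody-ex c)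
    sub-level ρ (all x R) b c = quant-level ∀′ ρ x R (BelowBody-all b) (BelowBody-all c)

    -- Both bodies are raised to a level above `k` and `l`; there one binder can be renamed to the
    -- other without capture.
    quant-level : ∀ q {k l} ρ x A → BelowBody k ρ x A → BelowBody l ρ x A →
                  quant q k (sub (suc k) (ρ [ x ≔ var k ]) A) ≈ quant q l (sub (suc l) (ρ [ x ≔ var l ]) A)
    quant-level q {k} {l} ρ x A b c =
      ≈-trans (body-level q ρ x A b (s≤s (m≤m⊔n k l)))
        (≈-trans (sub-rename q ρ x A (s≤s (m≤m⊔n k l)) (s≤s (m≤n⊔m k l))
                   (BelowBody-fresh {ρ = ρ} b) (BelowBody-fresh {ρ = ρ} c))
          (≈-sym (body-level q ρ x A c (s≤s (m≤n⊔m k l)))))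

    body-level : ∀ q {k m} ρ x A → BelowBody k ρ x A → k < m →
                 quant q k (sub (suc k) (ρ [ x ≔ var k ]) A) ≈ quant q k (sub m (ρ [ x ≔ var k ]) A)
    body-level q {k} ρ x A b k<m =
      quant-cong q k (sub-level (ρ [ x ≔ var k ]) A
        (BelowEnv-update ρ x A (n≤1+n k) b (Below-var k))
        (BelowEnv-update ρ x A (<⇒≤ k<m) b (Below-≤ (var k) k<m (Below-var k))))

    ⋁-level : ∀ {k l} ρ Rs → (∀ {z} → Anyˡ (z FreeIn_) Rs → Below k (ρ z)) →
              (∀ {z} → Anyˡ (z FreeIn_) Rs → Below l (ρ z)) → ⋁ (subList k ρ Rs) ≈ ⋁ (subList l ρ Rs)
    ⋁-level ρ []       b c = ≈-refl
    ⋁-level ρ (R ∷ Rs) b c =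
      ⋁-cong (subList _ ρ Rs) (subList _ ρ Rs)
        (sub-level ρ R (λ i → b (here i)) (λ i → c (here i)))
        (⋁-level ρ Rs (λ i → b (there i)) (λ i → c (there i)))

    ⋀-level : ∀ {k l} ρ Rs → (∀ {z} → Anyˡ (z FreeIn_) Rs → Below k (ρ z)) →
              (∀ {z} → Anyˡ (z FreeIn_) Rs → Below l (ρ z)) → ⋀ (subList k ρ Rs) ≈ ⋀ (subList l ρ Rs)
    ⋀-level ρ []       b c = ≈-refl
    ⋀-level ρ (R ∷ Rs) b c =
      ⋀-cong (subList _ ρ Rs) (subList _ ρ Rs)
        (sub-level ρ R (λ i → b (here i)) (λ i → c (here i)))
        (⋀-level ρ Rs (λ i → b (there i)) (λ i → c (there i)))

  mutual
    sub-id : ∀ {k} A → BelowEnv k var A → sub k var A ≈ A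
    sub-id 𝖿                      b = ≈-refl
    sub-id 𝗍                      b = ≈-refl
    sub-id (atom (mkAtom ± p ts)) b = ≡⇒≈ (cong (atom ∘ mkAtom ± p) (tsubs-id ts))
    sub-id (disj (R ∷ Rs)) b =
      ⋁-cong (subList _ var Rs) Rs (sub-id R (λ i → b (disj (here i)))) (⋁-id Rs (λ i → b (disj (there i))))
    sub-id (conj (R ∷ Rs)) b =
      ⋀-cong (subList _ var Rs) Rs (sub-id R (λ i → b (conj (here i)))) (⋀-id Rs (λ i → b (conj (there i))))
    sub-id (neg R)   b = neg-cong (sub-id R (λ i → b (neg i)))
    sub-id (ex x R)  b = quant-id ∃′ x R (BelowBody-ex b)
    sub-id (all x R) b = quant-id ∀′ x R (BelowBody-all b)

    quant-id : ∀ q {k} x A → BelowBody k var x A →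
               quant q k (sub (suc k) (var [ x ≔ var k ]) A) ≈ quant q x A
    quant-id q {k} x A b =
      ≈-trans (body-level q var x A b k<m)
        (≈-trans (sub-rename q var x A k<m x<m (BelowBody-fresh {ρ = var} b) λ { x≢x _ var → x≢x refl })
          (quant-cong q x
            (≈-trans (≡⇒≈ (sub-cong m A λ {z} _ → update-var x z)) (sub-id A below))))
      where
      -- The original name `x` need not be below `k`. With the inner binders moved above it, it can
      -- be restored as the outer binder.
      m   = suc (k ⊔ x)
      k<m = s≤s (m≤m⊔n k x)
      x<m = s≤s (m≤n⊔m k x)
      below : BelowEnv m var A
      below {z} z∈ = subst (Below m) (update-var x z)
        (BelowEnv-update var x A (<⇒≤ k<m) b (Below-≤ (var x) x<m (Below-var x)) z∈)

    ⋁-id : ∀ {k} Rs → (∀ {z} → Anyˡ (z FreeIn_) Rs → Below k (var z)) → ⋁ (subList k var Rs) ≈ ⋁ Rs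
    ⋁-id []       b = ≈-refl
    ⋁-id (R ∷ Rs) b =
      ⋁-cong (subList _ var Rs) Rs (sub-id R (λ i → b (here i))) (⋁-id Rs (λ i → b (there i)))

    ⋀-id : ∀ {k} Rs → (∀ {z} → Anyˡ (z FreeIn_) Rs → Below k (var z)) → ⋀ (subList k var Rs) ≈ ⋀ Rs
    ⋀-id []       b = ≈-refl
    ⋀-id (R ∷ Rs) b =
      ⋀-cong (subList _ var Rs) Rs (sub-id R (λ i → b (here i))) (⋀-id Rs (λ i → b (there i)))

  -- Provability in KSgq

  -- Rule instances carry their own context, so placing one inside a further context means composing
  -- the two.
  _⊙_ : Context → Context → Context
  hole         ⊙ S′ = S′
  disj Ts S Us ⊙ S′ = disj Ts (S ⊙ S′) Us
  conj Ts S Us ⊙ S′ = conj Ts (S ⊙ S′) Us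
  ex x S       ⊙ S′ = ex x (S ⊙ S′)
  all x S      ⊙ S′ = all x (S ⊙ S′)

  ⊙-⟨⟩ : ∀ S S′ R → (S ⊙ S′) ⟨ R ⟩ ≡ S ⟨ S′ ⟨ R ⟩ ⟩
  ⊙-⟨⟩ hole           S′ R = refl
  ⊙-⟨⟩ (disj Ts S Us) S′ R = cong (λ T → disj (Ts ++⁺ (T ∷ Us))) (⊙-⟨⟩ S S′ R)
  ⊙-⟨⟩ (conj Ts S Us) S′ R = cong (λ T → conj (Ts ++⁺ (T ∷ Us))) (⊙-⟨⟩ S S′ R)
  ⊙-⟨⟩ (ex x S)       S′ R = cong (ex x) (⊙-⟨⟩ S S′ R)
  ⊙-⟨⟩ (all x S)      S′ R = cong (all x) (⊙-⟨⟩ S S′ R)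

  instance-⟨⟩ : ∀ {ρ P C} S → Instance ρ P C → Instance ρ (S ⟨ P ⟩) (S ⟨ C ⟩)
  instance-⟨⟩ {ρ} S i = go i
    where
    at : ∀ S′ {P C} → Instance ρ ((S ⊙ S′) ⟨ P ⟩) ((S ⊙ S′) ⟨ C ⟩) →
         Instance ρ (S ⟨ S′ ⟨ P ⟩ ⟩) (S ⟨ S′ ⟨ C ⟩ ⟩)
    at S′ {P} {C} = subst₂ (Instance ρ) (⊙-⟨⟩ S S′ P) (⊙-⟨⟩ S S′ C)
    go : ∀ {P C} → Instance ρ P C → Instance ρ (S ⟨ P ⟩) (S ⟨ C ⟩)
    go (i↓ S′ R)       = at S′ (i↓ _ R)
    go (i↑ S′ R)       = at S′ (i↑ _ R)
    go (s S′ R T U)    = at S′ (s _ R T U)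
    go (w↓ S′ R)       = at S′ (w↓ _ R)
    go (w↑ S′ R)       = at S′ (w↑ _ R)
    go (c↓ S′ R)       = at S′ (c↓ _ R)
    go (c↑ S′ R)       = at S′ (c↑ _ R)
    go (u↓ S′ x R T)   = at S′ (u↓ _ x R T)
    go (u↑ S′ x R T)   = at S′ (u↑ _ x R T)
    go (n↓ S′ x t R f) = at S′ (n↓ _ x t R f)
    go (n↑ S′ x t R f) = at S′ (n↑ _ x t R f)

  derivation-⟨⟩ : ∀ {𝒮 P C} S → Derivation 𝒮 P C → Derivation 𝒮 (S ⟨ P ⟩) (S ⟨ C ⟩)
  derivation-⟨⟩ S (single e)         = single (ctx-cong S e)
  derivation-⟨⟩ S (extend d e m i f) =
    extend (derivation-⟨⟩ S d) (ctx-cong S e) m (instance-⟨⟩ S i) (ctx-cong S f)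

  derivation-≈ : ∀ {𝒮 P C C′} → Derivation 𝒮 P C → C ≈ C′ → Derivation 𝒮 P C′
  derivation-≈ (single e)         f = single (≈-trans e f)
  derivation-≈ (extend d e m i g) f = extend d e m i (≈-trans g f)

  derivation-trans : ∀ {𝒮 P Q C} → Derivation 𝒮 P Q → Derivation 𝒮 Q C → Derivation 𝒮 P C
  derivation-trans d (single e)          = derivation-≈ d e
  derivation-trans d (extend d′ e m i f) = extend (derivation-trans d d′) e m i f

  Provable : Pred Structure 0ℓ
  Provable = Proof KSgq

  infixl 4 _▷_
  _▷_ : ∀ {R T} → Provable R → R ≈ T → Provable T
  _▷_ = derivation-≈

  apply : ∀ {ρ P C} → ρ ∈ KSgq → Instance ρ P C → Provable P → Provable C
  apply m i d = extend d ≈-refl m i ≈-refl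

  swap : ∀ {R T} → Provable (R ∨ T) → Provable (T ∨ R)
  swap d = d ▷ disj-comm _ _

  assocʳ : ∀ {R T U} → Provable ((R ∨ T) ∨ U) → Provable (R ∨ (T ∨ U))
  assocʳ d = d ▷ ∨-assoc _ _ _

  assocˡ : ∀ {R T U} → Provable (R ∨ (T ∨ U)) → Provable ((R ∨ T) ∨ U)
  assocˡ d = d ▷ ≈-sym (∨-assoc _ _ _)

  weaken : ∀ {R} T → Provable R → Provable (R ∨ T)
  weaken {R} T d = apply (there (there (here refl))) (w↓ (disj (R ∷ []) hole []) T) (d ▷ ≈-sym (∨𝖿 R))

  contract : ∀ {R} → Provable (R ∨ R) → Provable R
  contract {R} = apply (there (there (there (here refl)))) (c↓ hole R)

  absorb : ∀ {R T} → Provable (T ∨ (R ∨ T)) → Provable (R ∨ T)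
  absorb {R} {T} d =
    apply (there (there (there (here refl)))) (c↓ (disj (R ∷ []) hole []) T) (assocʳ (swap d))

  excluded-middle : ∀ R → Provable (R ∨ neg R)
  excluded-middle R = apply (here refl) (i↓ hole R) (single ≈-refl)

  -- Deep inference simulates the two-premise rule: the second proof runs inside the conclusion of
  -- the first, in place of a unit 𝗍. Two switches bring both copies of Γ out, where they are
  -- contracted.
  ∧-intro : ∀ Γ {R T} → Provable (Γ ∨ R) → Provable (Γ ∨ T) → Provable (Γ ∨ (R ∧ T))
  ∧-intro Γ {R} {T} d e = contract-Γ (switch-T (switch-R both))
    where
    both : Provable ((R ∨ Γ) ∧ (Γ ∨ T))
    both = derivation-trans (derivation-≈ (swap d) (≈-sym (∧𝗍 (R ∨ Γ))))
             (derivation-⟨⟩ (conj ((R ∨ Γ) ∷ []) hole []) e)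
    switch-R : Provable ((R ∨ Γ) ∧ (Γ ∨ T)) → Provable ((R ∧ (Γ ∨ T)) ∨ Γ)
    switch-R = apply (there (here refl)) (s hole R (Γ ∨ T) Γ)
    switch-T : Provable ((R ∧ (Γ ∨ T)) ∨ Γ) → Provable (((T ∧ R) ∨ Γ) ∨ Γ)
    switch-T f = apply (there (here refl)) (s (disj [] hole (Γ ∷ [])) T R Γ)
      (f ▷ ∨-congˡ Γ (≈-trans (conj-comm R (Γ ∨ T)) (∧-congˡ R (disj-comm Γ T))))
    contract-Γ : Provable (((T ∧ R) ∨ Γ) ∨ Γ) → Provable (Γ ∨ (R ∧ T))
    contract-Γ f = swap (absorb (swap (f ▷ ∨-congˡ Γ (∨-congˡ Γ (conj-comm T R)))))

  -- The given proof is run under a vacuous ∀ on 𝗍. `u↓` then splits the quantifier, and the ∃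
  -- falling on Γ is vacuous by freshness.
  ∀-intro : ∀ {Γ R k} → ¬ k FreeIn Γ → Provable (Γ ∨ R) → Provable (Γ ∨ all k R)
  ∀-intro {Γ} {R} {k} k∉Γ d =
    swap (apply (there (there (there (there (here refl))))) (u↓ hole k R Γ)
        (derivation-trans (single (≈-sym (all-vacuous λ ()))) (derivation-⟨⟩ (all k hole) (swap d)))
      ▷ ∨-congʳ (all k R) (ex-vacuous k∉Γ))

  ∃-intro : ∀ {Γ R k t} → FreeFor t k R → Provable (Γ ∨ R [ k / t ]) → Provable (Γ ∨ ex k R)
  ∃-intro {Γ} {R} {k} {t} f =
    apply (there (there (there (there (there (here refl)))))) (n↓ (disj (Γ ∷ []) hole []) k t R f)

  -- Orthogonality

  infix 10 _⊥
  _⊥ : Pred Structure 0ℓ → Pred Structure 0ℓ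
  (X ⊥) Γ = ∀ Δ → Δ ∈ X → Provable (Γ ∨ Δ)

  Stable : Pred Structure 0ℓ → Set
  Stable X = X ⊥ ⊥ ⊆′ X

  ⊥-anti : ∀ {X Y} → X ⊆′ Y → Y ⊥ ⊆′ X ⊥
  ⊥-anti X⊆Y Γ Γ∈ Δ Δ∈X = Γ∈ Δ (X⊆Y Δ Δ∈X)

  ⊥⊥-intro : ∀ {X} → X ⊆′ X ⊥ ⊥
  ⊥⊥-intro Γ Γ∈X Δ Δ∈X⊥ = swap (Δ∈X⊥ Γ Γ∈X)

  ⊥-stable : ∀ X → Stable (X ⊥)
  ⊥-stable X = ⊥-anti {X} (⊥⊥-intro {X})

  ∩-stable : ∀ {X Y} → Stable X → Stable Y → Stable (X ∩ Y)
  ∩-stable {X} {Y} sX sY Γ Γ∈ =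
    sX Γ (λ Δ Δ∈X⊥ → Γ∈ Δ λ Σ Σ∈ → Δ∈X⊥ Σ (proj₁ Σ∈)) ,
    sY Γ (λ Δ Δ∈Y⊥ → Γ∈ Δ λ Σ Σ∈ → Δ∈Y⊥ Σ (proj₂ Σ∈))

  ⋂-stable : ∀ {I : Set} {X : I → Pred Structure 0ℓ} → (∀ i → Stable (X i)) → Stable (⋂ I X)
  ⋂-stable sX Γ Γ∈ i = sX i Γ λ Δ Δ∈ → Γ∈ Δ λ Σ Σ∈ → Δ∈ Σ (Σ∈ i)

  -- The unit 𝖿 is orthogonal to every provable structure, so it can serve as the test.
  Provable-stable : Stable Provable
  Provable-stable Γ Γ∈ = Γ∈ 𝖿 (λ Δ p → p ▷ ≈-sym (𝖿∨ Δ)) ▷ ∨𝖿 Γ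

  weaken-⊥ʳ : ∀ {X} Γ Δ → Γ ∈ X ⊥ → (Γ ∨ Δ) ∈ X ⊥
  weaken-⊥ʳ Γ Δ Γ∈ Σ Σ∈ = swap (assocʳ (weaken Δ (swap (Γ∈ Σ Σ∈))))

  weaken-⊥ˡ : ∀ {X} Γ Δ → Γ ∈ X ⊥ → (Δ ∨ Γ) ∈ X ⊥
  weaken-⊥ˡ Γ Δ Γ∈ Σ Σ∈ = assocˡ (swap (weaken Δ (Γ∈ Σ Σ∈)))

  -- A stable set is the orthogonal of `X ⊥`, and orthogonals inherit weakening from provability.
  weaken-stableʳ : ∀ {X} → Stable X → ∀ Γ Δ → Γ ∈ X → (Γ ∨ Δ) ∈ X
  weaken-stableʳ {X} sX Γ Δ Γ∈ = sX (Γ ∨ Δ) (weaken-⊥ʳ {X ⊥} Γ Δ (⊥⊥-intro {X} Γ Γ∈))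

  weaken-stableˡ : ∀ {X} → Stable X → ∀ Γ Δ → Γ ∈ X → (Δ ∨ Γ) ∈ X
  weaken-stableˡ {X} sX Γ Δ Γ∈ = sX (Δ ∨ Γ) (weaken-⊥ˡ {X ⊥} Γ Δ (⊥⊥-intro {X} Γ Γ∈))

  ⊥-cong : ∀ {X Y} → X ≐′ Y → X ⊥ ≐′ Y ⊥
  ⊥-cong {X} {Y} (f , g) = ⊥-anti {Y} {X} g , ⊥-anti {X} {Y} f

  ∩-cong : ∀ {X X′ Y Y′ : Pred Structure 0ℓ} → X ≐′ X′ → Y ≐′ Y′ → X ∩ Y ≐′ X′ ∩ Y′
  ∩-cong (f , g) (h , i) =
    (λ Γ Γ∈ → f Γ (proj₁ Γ∈) , h Γ (proj₂ Γ∈)) , (λ Γ Γ∈ → g Γ (proj₁ Γ∈) , i Γ (proj₂ Γ∈))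

  ⋂-cong : ∀ {I : Set} {X Y : I → Pred Structure 0ℓ} → (∀ i → X i ≐′ Y i) → ⋂ I X ≐′ ⋂ I Y
  ⋂-cong e = (λ Γ Γ∈ i → proj₁ (e i) Γ (Γ∈ i)) , (λ Γ Γ∈ i → proj₂ (e i) Γ (Γ∈ i))

  signed : Sign → Pred Structure 0ℓ → Pred Structure 0ℓ
  signed Sign.+ X = X
  signed Sign.- X = X ⊥

  signed-stable : ∀ ± {X} → Stable X → Stable (signed ± X)
  signed-stable Sign.+ sX = sX
  signed-stable Sign.- {X} sX = ⊥-stable X

  signed-cong : ∀ ± {X Y} → X ≐′ Y → signed ± X ≐′ signed ± Y
  signed-cong Sign.+ e = e
  signed-cong Sign.- e = ⊥-cong e

  -- Interpretation of structures

  -- Disjunctions and existential quantifiers are interpreted as the negations of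
  -- the dual intersections; negative atoms as the negations of positive ones.
  mutual
    ⟦_⟧ : Structure → Env → Pred Structure 0ℓ
    ⟦ 𝖿 ⟧ ρ                    = Provable
    ⟦ 𝗍 ⟧ ρ                    = U
    ⟦ atom (mkAtom ± p ts) ⟧ ρ = signed ± (λ Γ → Provable (Γ ∨ atom (mkAtom Sign.+ p (tsubs ρ ts))))
    ⟦ disj (R ∷ Rs) ⟧ ρ        = (⟦ R ⟧ ρ ⊥ ∩ ⋂⟦ Rs ⟧ Sign.- ρ) ⊥
    ⟦ conj (R ∷ Rs) ⟧ ρ        = ⟦ R ⟧ ρ ∩ ⋂⟦ Rs ⟧ Sign.+ ρ
    ⟦ neg R ⟧ ρ                = ⟦ R ⟧ ρ ⊥
    ⟦ ex x R ⟧ ρ               = ⋂ Term (λ t → ⟦ R ⟧ (ρ [ x ≔ t ]) ⊥) ⊥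
    ⟦ all x R ⟧ ρ              = ⋂ Term (λ t → ⟦ R ⟧ (ρ [ x ≔ t ]))

    ⋂⟦_⟧ : List Structure → Sign → Env → Pred Structure 0ℓ
    ⋂⟦ [] ⟧     ± ρ = U
    ⋂⟦ R ∷ Rs ⟧ ± ρ = signed ± (⟦ R ⟧ ρ) ∩ ⋂⟦ Rs ⟧ ± ρ

  -- This set is the orthogonal of the single structure `A`, so `A` itself is the test to use.
  atom-stable : ∀ A → Stable (λ Γ → Provable (Γ ∨ A))
  atom-stable A Γ Γ∈ = Γ∈ A λ Δ → swap

  mutual
    ⟦⟧-stable : ∀ R ρ → Stable (⟦ R ⟧ ρ)
    ⟦⟧-stable 𝖿                      ρ = Provable-stable
    ⟦⟧-stable 𝗍                      ρ = λ _ _ → tt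
    ⟦⟧-stable (atom (mkAtom ± p ts)) ρ = signed-stable ± (atom-stable _)
    ⟦⟧-stable (disj (R ∷ Rs))        ρ = ⊥-stable (⟦ R ⟧ ρ ⊥ ∩ ⋂⟦ Rs ⟧ Sign.- ρ)
    ⟦⟧-stable (conj (R ∷ Rs))        ρ = ∩-stable (⟦⟧-stable R ρ) (⋂⟦⟧-stable Rs Sign.+ ρ)
    ⟦⟧-stable (neg R)                ρ = ⊥-stable (⟦ R ⟧ ρ)
    ⟦⟧-stable (ex x R)               ρ = ⊥-stable (⋂ Term (λ t → ⟦ R ⟧ (ρ [ x ≔ t ]) ⊥))
    ⟦⟧-stable (all x R)              ρ = ⋂-stable λ t → ⟦⟧-stable R (ρ [ x ≔ t ])

    ⋂⟦⟧-stable : ∀ Rs ± ρ → Stable (⋂⟦ Rs ⟧ ± ρ)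
    ⋂⟦⟧-stable []       ± ρ = λ _ _ → tt
    ⋂⟦⟧-stable (R ∷ Rs) ± ρ = ∩-stable (signed-stable ± (⟦⟧-stable R ρ)) (⋂⟦⟧-stable Rs ± ρ)

  ≡⇒≐ : ∀ {X Y : Pred Structure 0ℓ} → X ≡ Y → X ≐′ Y
  ≡⇒≐ refl = ≐′-refl

  ⟦atom⟧-cong : ∀ ± p {ts us} → ts ≡ us →
                signed ± (λ Γ → Provable (Γ ∨ atom (mkAtom Sign.+ p ts))) ≐′
                signed ± (λ Γ → Provable (Γ ∨ atom (mkAtom Sign.+ p us)))
  ⟦atom⟧-cong ± p refl = ≐′-refl

  mutual
    ⟦⟧-cong : ∀ {ρ σ} R → (∀ {z} → z FreeIn R → ρ z ≡ σ z) → ⟦ R ⟧ ρ ≐′ ⟦ R ⟧ σ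
    ⟦⟧-cong 𝖿 eq = ≐′-refl
    ⟦⟧-cong 𝗍 eq = ≐′-refl
    ⟦⟧-cong (atom (mkAtom ± p ts)) eq = ⟦atom⟧-cong ± p (tsubs-cong ts λ i → eq (atom i))
    ⟦⟧-cong (disj (R ∷ Rs)) eq =
      ⊥-cong (∩-cong (⊥-cong (⟦⟧-cong R λ i → eq (disj (here i))))
              (⋂⟦⟧-cong Rs Sign.- λ i → eq (disj (there i))))
    ⟦⟧-cong (conj (R ∷ Rs)) eq =
      ∩-cong (⟦⟧-cong R λ i → eq (conj (here i))) (⋂⟦⟧-cong Rs Sign.+ λ i → eq (conj (there i)))
    ⟦⟧-cong (neg R)   eq = ⊥-cong (⟦⟧-cong R λ i → eq (neg i))
    ⟦⟧-cong (ex x R)  eq =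
      ⊥-cong (⋂-cong λ t → ⊥-cong (⟦⟧-cong R (update-cong x refl λ x≢z i → eq (ex (x≢z ∘ sym) i))))
    ⟦⟧-cong (all x R) eq =
      ⋂-cong λ t → ⟦⟧-cong R (update-cong x refl λ x≢z i → eq (all (x≢z ∘ sym) i))

    ⋂⟦⟧-cong : ∀ {ρ σ} Rs ± → (∀ {z} → Anyˡ (z FreeIn_) Rs → ρ z ≡ σ z) → ⋂⟦ Rs ⟧ ± ρ ≐′ ⋂⟦ Rs ⟧ ± σ
    ⋂⟦⟧-cong []       ± eq = ≐′-refl
    ⋂⟦⟧-cong (R ∷ Rs) ± eq =
      ∩-cong (signed-cong ± (⟦⟧-cong R λ i → eq (here i))) (⋂⟦⟧-cong Rs ± λ i → eq (there i))

  mutual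
    -- Serves the `notFree` clauses of `FreeFor`, which give no information about the body to
    -- recurse on.
    subst-notFree : ∀ {x t} R → ¬ x FreeIn R → R [ x / t ] ≡ R
    subst-notFree 𝖿 x∉ = refl
    subst-notFree 𝗍 x∉ = refl
    subst-notFree {x} {t} (atom (mkAtom ± p ts)) x∉ =
      cong (atom ∘ mkAtom ± p)
        (trans (substTerms-tsubs x t ts)
          (trans (tsubs-cong ts λ i → update-≢ var {x} t λ { refl → x∉ (atom i) }) (tsubs-id ts)))
    subst-notFree (disj (R ∷ Rs)) x∉ =
      cong₂ (λ T Ts → disj (T ∷ Ts)) (subst-notFree R λ i → x∉ (disj (here i)))
                                     (substList-notFree Rs λ i → x∉ (disj (there i)))
    subst-notFree (conj (R ∷ Rs)) x∉ =
      cong₂ (λ T Ts → conj (T ∷ Ts)) (subst-notFree R λ i → x∉ (conj (here i)))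
                                     (substList-notFree Rs λ i → x∉ (conj (there i)))
    subst-notFree (neg R)   x∉ = cong neg (subst-notFree R λ i → x∉ (neg i))
    subst-notFree (ex y R)  x∉ = cong (ex y) (subst-notFree-body y R λ x≢y i → x∉ (ex x≢y i))
    subst-notFree (all y R) x∉ = cong (all y) (subst-notFree-body y R λ x≢y i → x∉ (all x≢y i))

    subst-notFree-body : ∀ {x t} y R → (x ≢ y → ¬ x FreeIn R) →
                         (if does (x ≟ y) then R else R [ x / t ]) ≡ R
    subst-notFree-body {x} {t} y R x∉ = by-cases (x ≟ y)
      where
      by-cases : (d : Dec (x ≡ y)) → (if does d then R else R [ x / t ]) ≡ R
      by-cases (yes _)  = refl
      by-cases (no x≢y) = subst-notFree R (x∉ x≢y)

    substList-notFree : ∀ {x t} Rs → ¬ Anyˡ (x FreeIn_) Rs → substList x t Rs ≡ Rs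
    substList-notFree []       x∉ = refl
    substList-notFree (R ∷ Rs) x∉ =
      cong₂ _∷_ (subst-notFree R λ i → x∉ (here i)) (substList-notFree Rs λ i → x∉ (there i))

  ⟦⟧-subst-notFree : ∀ {x t} R ρ u → ¬ x FreeIn R → ⟦ R [ x / t ] ⟧ ρ ≐′ ⟦ R ⟧ (ρ [ x ≔ u ])
  ⟦⟧-subst-notFree {x} R ρ u x∉ =
    ≐′-trans (≡⇒≐ (cong (λ T → ⟦ T ⟧ ρ) (subst-notFree R x∉)))
      (⟦⟧-cong R λ z∈ → sym (update-≢ ρ {x} u λ { refl → x∉ z∈ }))

  mutual
    ⟦⟧-subst : ∀ {x t} R ρ → FreeFor t x R → ⟦ R [ x / t ] ⟧ ρ ≐′ ⟦ R ⟧ (ρ [ x ≔ tsub ρ t ])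
    ⟦⟧-subst 𝖿 ρ f = ≐′-refl
    ⟦⟧-subst 𝗍 ρ f = ≐′-refl
    ⟦⟧-subst (atom (mkAtom ± p ts)) ρ f = ⟦atom⟧-cong ± p (tsubs-substTerms ρ _ _ ts)
    ⟦⟧-subst (disj (R ∷ Rs)) ρ (disj (f ∷ fs)) =
      ⊥-cong (∩-cong (⊥-cong (⟦⟧-subst R ρ f)) (⋂⟦⟧-subst Rs Sign.- ρ fs))
    ⟦⟧-subst (conj (R ∷ Rs)) ρ (conj (f ∷ fs)) =
      ∩-cong (⟦⟧-subst R ρ f) (⋂⟦⟧-subst Rs Sign.+ ρ fs)
    ⟦⟧-subst (neg R) ρ (neg f) = ⊥-cong (⟦⟧-subst R ρ f)
    ⟦⟧-subst (ex y R)  ρ (ex-notFree x∉)     = ⟦⟧-subst-notFree (ex y R) ρ _ x∉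
    ⟦⟧-subst (ex y R)  ρ (ex-noClash y∉t f)  = ⊥-cong (⋂-cong λ u → ⊥-cong (⟦⟧-subst-body y R ρ u y∉t f))
    ⟦⟧-subst (all y R) ρ (all-notFree x∉)    = ⟦⟧-subst-notFree (all y R) ρ _ x∉
    ⟦⟧-subst (all y R) ρ (all-noClash y∉t f) = ⋂-cong λ u → ⟦⟧-subst-body y R ρ u y∉t f

    -- If `x` is the binder, the inner update overrides its value. Otherwise `y` is absent from `t`,
    -- so the value of `t` survives the update of `y` and the two updates commute.
    ⟦⟧-subst-body : ∀ {x t} y R ρ u → ¬ y OccursIn t → FreeFor t x R →
                    ⟦ if does (x ≟ y) then R else R [ x / t ] ⟧ (ρ [ y ≔ u ]) ≐′
                    ⟦ R ⟧ (ρ [ x ≔ tsub ρ t ] [ y ≔ u ])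
    ⟦⟧-subst-body {x} {t} y R ρ u y∉t f = by-cases (x ≟ y)
      where
      by-cases : (d : Dec (x ≡ y)) →
                 ⟦ if does d then R else R [ x / t ] ⟧ (ρ [ y ≔ u ]) ≐′
                 ⟦ R ⟧ (ρ [ x ≔ tsub ρ t ] [ y ≔ u ])
      by-cases (yes refl) =
        ⟦⟧-cong R (update-cong {_FreeIn R} y refl λ y≢z _ → sym (update-≢ ρ (tsub ρ t) y≢z))
      by-cases (no x≢y) =
        ≐′-trans (⟦⟧-subst R (ρ [ y ≔ u ]) f)
          (⟦⟧-cong R λ {z} z∈ →
            trans (update-cong {_FreeIn R} {ρ [ y ≔ u ]} {ρ [ y ≔ u ]} x
                     (tsub-update-fresh ρ y u t y∉t) (λ _ _ → refl) z∈)
                  (update-comm ρ (tsub ρ t) u x≢y z))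

    ⋂⟦⟧-subst : ∀ {x t} Rs ± ρ → All (FreeFor t x) Rs →
                ⋂⟦ substList x t Rs ⟧ ± ρ ≐′ ⋂⟦ Rs ⟧ ± (ρ [ x ≔ tsub ρ t ])
    ⋂⟦⟧-subst []       ± ρ fs       = ≐′-refl
    ⋂⟦⟧-subst (R ∷ Rs) ± ρ (f ∷ fs) = ∩-cong (signed-cong ± (⟦⟧-subst R ρ f)) (⋂⟦⟧-subst Rs ± ρ fs)

  -- Soundness of all rules

  infix 4 _⊨_
  -- All environments are needed because a quantifier of a surrounding context changes the
  -- environment at the hole.
  _⊨_ : Structure → Structure → Set
  P ⊨ C = ∀ ρ → ⟦ P ⟧ ρ ⊆′ ⟦ C ⟧ ρ

  ++⁺-mono : ∀ Rs {Ts Us} ± ρ → ⋂⟦ toList Ts ⟧ ± ρ ⊆′ ⋂⟦ toList Us ⟧ ± ρ →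
             ⋂⟦ toList (Rs ++⁺ Ts) ⟧ ± ρ ⊆′ ⋂⟦ toList (Rs ++⁺ Us) ⟧ ± ρ
  ++⁺-mono []       ± ρ f Γ Γ∈        = f Γ Γ∈
  ++⁺-mono (R ∷ Rs) ± ρ f Γ (r , rs)  = r , ++⁺-mono Rs ± ρ f Γ rs

  ++-≐ : ∀ Rs Ts ± ρ → ⋂⟦ Rs ++ Ts ⟧ ± ρ ≐′ (⋂⟦ Rs ⟧ ± ρ ∩ ⋂⟦ Ts ⟧ ± ρ)
  ++-≐ []       Ts ± ρ = (λ _ ts → tt , ts) , (λ _ → proj₂)
  ++-≐ (R ∷ Rs) Ts ± ρ =
    (λ { Γ (r , rts) → let rs , ts = proj₁ (++-≐ Rs Ts ± ρ) Γ rts in (r , rs) , ts }) ,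
    (λ { Γ ((r , rs) , ts) → r , proj₂ (++-≐ Rs Ts ± ρ) Γ (rs , ts) })

  -- The hole is never negated; in a disjunction or under ∃ it sits below two orthogonals, whose
  -- reversals cancel.
  ⟨⟩-mono : ∀ S {P C} → P ⊨ C → S ⟨ P ⟩ ⊨ S ⟨ C ⟩
  ⟨⟩-mono hole           f ρ Γ Γ∈   = f ρ Γ Γ∈
  ⟨⟩-mono (disj Ts S Us) f ρ Γ Γ∈ Δ = Γ∈ Δ ∘
    ++⁺-mono Ts Sign.- ρ (λ { Σ (r , us) → (λ Π Π∈ → r Π (⟨⟩-mono S f ρ Π Π∈)) , us }) Δ
  ⟨⟩-mono (conj Ts S Us) f ρ        =
    ++⁺-mono Ts Sign.+ ρ (λ { Σ (r , us) → ⟨⟩-mono S f ρ Σ r , us })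
  ⟨⟩-mono (ex x S)       f ρ Γ Γ∈ Δ Δ∈ =
    Γ∈ Δ λ t Σ Σ∈ → Δ∈ t Σ (⟨⟩-mono S f (ρ [ x ≔ t ]) Σ Σ∈)
  ⟨⟩-mono (all x S)      f ρ Γ Γ∈ t    = ⟨⟩-mono S f (ρ [ x ≔ t ]) Γ (Γ∈ t)

  ∨-⊨-comm : ∀ R T → R ∨ T ⊨ T ∨ R
  ∨-⊨-comm R T ρ Γ Γ∈ Δ (t , r , _) = Γ∈ Δ (r , t , tt)

  ⟦⟧-rename : ∀ {x y R} ρ t → ¬ y FreeIn R → FreeFor (var y) x R →
              ⟦ R ⟧ (ρ [ x ≔ t ]) ≐′ ⟦ R [ x / var y ] ⟧ (ρ [ y ≔ t ])
  ⟦⟧-rename {x} {y} {R} ρ t y∉ f =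
    ≐′-trans
      (⟦⟧-cong R (update-cong {_FreeIn R} {ρ} {ρ [ y ≔ t ]} x (sym (update-≡ ρ y t))
        λ _ z∈ → sym (update-≢ ρ {y} t λ { refl → y∉ z∈ })))
      (≐′-sym (⟦⟧-subst R (ρ [ y ≔ t ]) f))

  ⟦⟧-vacuous : ∀ {y R} ρ t → ¬ y FreeIn R → ⟦ R ⟧ (ρ [ y ≔ t ]) ≐′ ⟦ R ⟧ ρ
  ⟦⟧-vacuous {y} {R} ρ t y∉ = ⟦⟧-cong R λ z∈ → update-≢ ρ {y} t λ { refl → y∉ z∈ }

  ≈-sound : ∀ {R T} → R ≈ T → ∀ ρ → ⟦ R ⟧ ρ ≐′ ⟦ T ⟧ ρ
  ≈-sound ≈-refl ρ        = ≐′-refl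
  ≈-sound (≈-sym e) ρ     = ≐′-sym (≈-sound e ρ)
  ≈-sound (≈-trans e f) ρ = ≐′-trans (≈-sound e ρ) (≈-sound f ρ)
  ≈-sound (ctx-cong S e) ρ =
    ⟨⟩-mono S (λ σ → proj₁ (≈-sound e σ)) ρ , ⟨⟩-mono S (λ σ → proj₂ (≈-sound e σ)) ρ
  ≈-sound (neg-cong e) ρ = ⊥-cong (≈-sound e ρ)
  -- The nested disjunction appears under a second orthogonal, and the double orthogonal of a stable
  -- intersection collapses.
  ≈-sound (disj-assoc Rs (T ∷ Ts) Us) ρ = ⊥-cong
    ( ++⁺-mono Rs Sign.- ρ (λ { Γ (tts , us) →
        let t , ts = ∩-stable (⊥-stable (⟦ T ⟧ ρ)) (⋂⟦⟧-stable Ts Sign.- ρ) Γ tts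
        in t , proj₂ (++-≐ Ts Us Sign.- ρ) Γ (ts , us) })
    , ++⁺-mono Rs Sign.- ρ (λ { Γ (t , tsus) →
        let ts , us = proj₁ (++-≐ Ts Us Sign.- ρ) Γ tsus
        in ⊥⊥-intro {⟦ T ⟧ ρ ⊥ ∩ ⋂⟦ Ts ⟧ Sign.- ρ} Γ (t , ts) , us }) )
  ≈-sound (conj-assoc Rs (T ∷ Ts) Us) ρ =
      ++⁺-mono Rs Sign.+ ρ (λ { Γ ((t , ts) , us) → t , proj₂ (++-≐ Ts Us Sign.+ ρ) Γ (ts , us) })
    , ++⁺-mono Rs Sign.+ ρ (λ { Γ (t , tsus) →
        let ts , us = proj₁ (++-≐ Ts Us Sign.+ ρ) Γ tsus in (t , ts) , us })
  ≈-sound (disj-comm R T) ρ = ∨-⊨-comm R T ρ , ∨-⊨-comm T R ρ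
  ≈-sound (conj-comm R T) ρ =
    (λ { Γ (r , t , _) → t , r , tt }) , (λ { Γ (t , r , _) → r , t , tt })
  ≈-sound 𝖿∧𝖿 ρ = (λ Γ → proj₁) , (λ Γ p → p , p , tt)
  ≈-sound (𝖿∨ R) ρ =
    (λ Γ Γ∈ → ⟦⟧-stable R ρ Γ λ Δ Δ∈ → Γ∈ Δ ((λ Σ p → swap (weaken Δ p)) , Δ∈ , tt)) ,
    (λ { Γ r Δ (_ , Δ∈ , _) → swap (Δ∈ Γ r) })
  ≈-sound 𝗍∨𝗍 ρ = (λ _ _ → tt) , (λ { Γ _ Δ (Δ∈ , _) → swap (Δ∈ Γ tt) })
  ≈-sound (𝗍∧ R) ρ = (λ Γ → proj₁ ∘ proj₂) , (λ Γ r → tt , r , tt)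
  ≈-sound neg-𝖿 ρ = (λ _ _ → tt) , (λ Γ _ Δ p → swap (weaken Γ p))
  -- A structure orthogonal to everything is orthogonal to itself, so contraction proves it.
  ≈-sound neg-𝗍 ρ = (λ Γ Γ∈ → contract (Γ∈ Γ tt)) , (λ Γ p Δ _ → weaken Δ p)
  ≈-sound (neg-atom (mkAtom Sign.+ p ts)) ρ = ≐′-refl
  ≈-sound (neg-atom (mkAtom Sign.- p ts)) ρ = atom-stable A , ⊥⊥-intro {λ Γ → Provable (Γ ∨ A)}
    where A = atom (mkAtom Sign.+ p (tsubs ρ ts))
  ≈-sound (neg-disj R T) ρ =
    ∩-stable (⊥-stable (⟦ R ⟧ ρ)) (∩-stable (⊥-stable (⟦ T ⟧ ρ)) (λ _ _ → tt)) ,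
    ⊥⊥-intro {⟦ R ⟧ ρ ⊥ ∩ (⟦ T ⟧ ρ ⊥ ∩ U)}
  ≈-sound (neg-conj R T) ρ = ⊥-cong (≐′-sym
    (∩-cong (⟦⟧-stable R ρ , ⊥⊥-intro {⟦ R ⟧ ρ}) (∩-cong (⟦⟧-stable T ρ , ⊥⊥-intro {⟦ T ⟧ ρ}) ≐′-refl)))
  ≈-sound (neg-neg R) ρ = ⟦⟧-stable R ρ , ⊥⊥-intro {⟦ R ⟧ ρ}
  ≈-sound (neg-ex x R) ρ =
    ⋂-stable (λ t → ⊥-stable (⟦ R ⟧ (ρ [ x ≔ t ]))) , ⊥⊥-intro {⋂ Term (λ t → ⟦ R ⟧ (ρ [ x ≔ t ]) ⊥)}
  ≈-sound (neg-all x R) ρ = ⊥-cong (⋂-cong λ t → ≐′-sym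
    (⟦⟧-stable R (ρ [ x ≔ t ]) , ⊥⊥-intro {⟦ R ⟧ (ρ [ x ≔ t ])}))
  ≈-sound (all-rename y∉ f) ρ = ⋂-cong λ t → ⟦⟧-rename ρ t y∉ f
  ≈-sound (ex-rename y∉ f) ρ  = ⊥-cong (⋂-cong λ t → ⊥-cong (⟦⟧-rename ρ t y∉ f))
  -- `var 0` is an arbitrary term: what matters is that the domain is inhabited.
  ≈-sound (all-vacuous y∉) ρ  =
    (λ Γ Γ∈ → proj₁ (⟦⟧-vacuous ρ (var 0) y∉) Γ (Γ∈ (var 0))) ,
    (λ Γ Γ∈ t → proj₂ (⟦⟧-vacuous ρ t y∉) Γ Γ∈)
  ≈-sound (ex-vacuous {y} {R} y∉) ρ =
    (λ Γ Γ∈ → ⟦⟧-stable R ρ Γ λ Δ Δ∈ → Γ∈ Δ λ t Σ Σ∈ → Δ∈ Σ (proj₁ (⟦⟧-vacuous ρ t y∉) Σ Σ∈)) ,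
    (λ Γ Γ∈ Δ Δ∈ → swap (Δ∈ (var 0) Γ (proj₂ (⟦⟧-vacuous ρ (var 0) y∉) Γ Γ∈)))

  instance-sound : ∀ {r P C} → Instance r P C → P ⊨ C
  instance-sound (i↓ S R) = ⟨⟩-mono S λ ρ Γ _ Δ (Δ∈ , Δ∈′ , _) → swap (weaken Γ (contract (Δ∈′ Δ Δ∈)))
  instance-sound (i↑ S R) = ⟨⟩-mono S λ ρ Γ (Γ∈ , Γ∈′ , _) → contract (Γ∈′ Γ Γ∈)
  -- The disjunction is tested against Δ ∨ Γ instead of Δ, and the extra Γ is contracted. The added
  -- Γ is what lets Γ ∨ Σ, for Σ in R, lie in both R and T by weakening.
  instance-sound (s S R T U) = ⟨⟩-mono S λ ρ Γ (ru , t , _) Δ (rt , u , _) →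
    swap (absorb (ru (Δ ∨ Γ)
      ( (λ Σ Σ∈ → assocˡ (rt (Γ ∨ Σ)
          ( weaken-stableˡ (⟦⟧-stable R ρ) Σ Γ Σ∈
          , weaken-stableʳ (⟦⟧-stable T ρ) Γ Σ t
          , tt)))
      , weaken-⊥ʳ {⟦ U ⟧ ρ} Δ Γ u
      , tt)))
  instance-sound (w↓ S R) = ⟨⟩-mono S λ ρ Γ p → ⟦⟧-stable R ρ Γ λ Δ _ → weaken Δ p
  instance-sound (w↑ S R) = ⟨⟩-mono S λ _ _ _ → tt
  instance-sound (c↓ S R) = ⟨⟩-mono S λ ρ Γ Γ∈ → ⟦⟧-stable R ρ Γ λ Δ Δ∈ → Γ∈ Δ (Δ∈ , Δ∈ , tt)
  instance-sound (c↑ S R) = ⟨⟩-mono S λ ρ Γ Γ∈ → Γ∈ , Γ∈ , tt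
  -- Dually to the switch, Δ is doubled: Γ ∨ Δ lies in every instance of R, because for Σ orthogonal
  -- to R the structure Δ ∨ Σ is orthogonal to both R and T.
  instance-sound (u↓ S x R T) = ⟨⟩-mono S λ ρ Γ Γ∈ Δ (r , t , _) →
    absorb (r (Γ ∨ Δ) λ u → ⟦⟧-stable R (ρ [ x ≔ u ]) (Γ ∨ Δ) λ Σ Σ∈ → assocˡ (Γ∈ u (Δ ∨ Σ)
      ( weaken-⊥ˡ {⟦ R ⟧ (ρ [ x ≔ u ])} Σ Δ Σ∈
      , weaken-⊥ʳ {⟦ T ⟧ (ρ [ x ≔ u ])} Δ Σ (⋂-stable (λ v → ⊥-stable (⟦ T ⟧ (ρ [ x ≔ v ]))) Δ t u)
      , tt)))
  instance-sound (u↑ S x R T) = ⟨⟩-mono S λ ρ Γ (r , t , _) Δ Δ∈ →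
    swap (absorb (r (Δ ∨ Γ) λ u Σ Σ∈ → assocˡ (Δ∈ u (Γ ∨ Σ)
      ( weaken-stableˡ (⟦⟧-stable R (ρ [ x ≔ u ])) Σ Γ Σ∈
      , weaken-stableʳ (⟦⟧-stable T (ρ [ x ≔ u ])) Γ Σ (t u)
      , tt))))
  instance-sound (n↓ S x t R f) = ⟨⟩-mono S λ ρ Γ Γ∈ Δ Δ∈ →
    swap (Δ∈ (tsub ρ t) Γ (proj₁ (⟦⟧-subst R ρ f) Γ Γ∈))
  instance-sound (n↑ S x t R f) = ⟨⟩-mono S λ ρ Γ Γ∈ → proj₂ (⟦⟧-subst R ρ f) Γ (Γ∈ (tsub ρ t))

  -- With `𝒮` arbitrary, all five extended systems are covered at once; KSgq enters only through the
  -- orthogonality relation.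
  derivation-sound : ∀ {𝒮 P C} → Derivation 𝒮 P C → P ⊨ C
  derivation-sound (single e) ρ = proj₁ (≈-sound e ρ)
  derivation-sound (extend d e _ i f) ρ Γ =
    proj₁ (≈-sound f ρ) Γ ∘ instance-sound i ρ Γ ∘ proj₁ (≈-sound e ρ) Γ ∘ derivation-sound d ρ Γ

  -- Completeness of the interpretation

  infix 4 _⊑_
  _⊑_ : Pred Structure 0ℓ → Structure → Set
  X ⊑ R = ∀ Γ → Γ ∈ X → Provable (Γ ∨ R)

  ⊑-⊆ : ∀ {X Y R} → X ⊆′ Y → Y ⊑ R → X ⊑ R
  ⊑-⊆ X⊆Y Y⊑R Γ Γ∈ = Y⊑R Γ (X⊆Y Γ Γ∈)

  ⊑-≈ : ∀ {X R T} → X ⊑ R → R ≈ T → X ⊑ T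
  ⊑-≈ X⊑R e Γ Γ∈ = X⊑R Γ Γ∈ ▷ ∨-congʳ Γ e

  ⊑-𝗍 : ∀ {X} → X ⊑ 𝗍
  ⊑-𝗍 Γ _ = swap (weaken Γ (single ≈-refl))

  Provable-⊑ : Provable ⊑ 𝖿
  Provable-⊑ Γ = weaken 𝖿

  U⊥-⊑ : ∀ {R} → U ⊥ ⊑ R
  U⊥-⊑ {R} Γ Γ∈ = weaken R (contract (Γ∈ Γ tt))

  ⊑-∧ : ∀ {X Y R T} → X ⊑ R → Y ⊑ T → X ∩ Y ⊑ R ∧ T
  ⊑-∧ X⊑R Y⊑T Γ (Γ∈X , Γ∈Y) = ∧-intro Γ (X⊑R Γ Γ∈X) (Y⊑T Γ Γ∈Y)

  -- By stability R lies in X and T in Y, so after weakening R ∨ T lies in both and is itself the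
  -- test for Γ.
  ⊑-∨ : ∀ {X Y R T} → Stable X → Stable Y → X ⊥ ⊑ R → Y ⊥ ⊑ T → (X ∩ Y) ⊥ ⊑ R ∨ T
  ⊑-∨ {X} {Y} {R} {T} sX sY X⊑R Y⊑T Γ Γ∈ = Γ∈ (R ∨ T)
    ( weaken-stableʳ {X} sX R T (sX R λ Δ Δ∈ → swap (X⊑R Δ Δ∈))
    , weaken-stableˡ {Y} sY T R (sY T λ Δ Δ∈ → swap (Y⊑T Δ Δ∈)) )

  -- The eigenvariable is picked only once Γ is known, above its free variables; `k` keeps it clear
  -- of the environment too. The body `C` depends on that choice, hence the equivalence with R.
  ⊑-∀ : ∀ {X : Term → Pred Structure 0ℓ} {R} k →
        (∀ l → k ≤ l → ∃ λ C → X (var l) ⊑ C × all l C ≈ R) → ⋂ Term X ⊑ R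
  ⊑-∀ k h Γ Γ∈ =
    let l , b       = boundStructure Γ
        C , X⊑C , e = h (k ⊔ l) (m≤m⊔n k l)
        fresh       = λ i → <-irrefl refl (<-≤-trans (b i) (m≤n⊔m k l))
    in ∀-intro fresh (X⊑C Γ (Γ∈ (var (k ⊔ l)))) ▷ ∨-congʳ Γ e

  ⊑-∃ : ∀ {X : Term → Pred Structure 0ℓ} {R} → (∀ t → Stable (X t)) →
        (∀ t → X t ⊥ ⊑ R) → ⋂ Term X ⊥ ⊑ R
  ⊑-∃ {R = R} sX h Γ Γ∈ = Γ∈ R λ t → sX t R λ Δ Δ∈ → swap (h t Δ Δ∈)

  ⊑-ex : ∀ {X R k t} → FreeFor t k R → X ⊑ R [ k / t ] → X ⊑ ex k R
  ⊑-ex f X⊑R Γ Γ∈ = ∃-intro f (X⊑R Γ Γ∈)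

  ¬⋁-∷ : ∀ R Rs → neg R ∧ neg (⋁ Rs) ≈ neg (disj (R ∷ Rs))
  ¬⋁-∷ R Rs = ≈-sym (≈-trans (neg-cong (disj-∷ R Rs)) (neg-disj R (⋁ Rs)))

  ¬⋀-∷ : ∀ R Rs → neg R ∨ neg (⋀ Rs) ≈ neg (conj (R ∷ Rs))
  ¬⋀-∷ R Rs = ≈-sym (≈-trans (neg-cong (conj-∷ R Rs)) (neg-conj R (⋀ Rs)))

  ⟦atom⟧-⊑ : ∀ ± p ts → signed ± (λ Γ → Provable (Γ ∨ atom (mkAtom Sign.+ p ts))) ⊑ atom (mkAtom ± p ts)
  ⟦atom⟧-⊑ Sign.+ p ts Γ d  = d
  ⟦atom⟧-⊑ Sign.- p ts Γ Γ∈ =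
    Γ∈ A (swap (excluded-middle (atom (mkAtom Sign.+ p ts))) ▷ ∨-congˡ _ (neg-atom _))
    where A = atom (mkAtom Sign.- p ts)

  ⟦atom⟧⊥-⊑ : ∀ ± p ts →
              signed ± (λ Γ → Provable (Γ ∨ atom (mkAtom Sign.+ p ts))) ⊥ ⊑ neg (atom (mkAtom ± p ts))
  ⟦atom⟧⊥-⊑ Sign.+ p ts Γ Γ∈ = Γ∈ _ (swap (excluded-middle (atom (mkAtom Sign.+ p ts))))
  ⟦atom⟧⊥-⊑ Sign.- p ts Γ Γ∈ =
    atom-stable (atom (mkAtom Sign.+ p ts)) Γ Γ∈ ▷ ∨-congʳ Γ (≈-sym (neg-atom (mkAtom Sign.- p ts)))

  mutual
    -- Together with `⟦⟧⊥-⊑` and up to stability: `sub k ρ A` is in the orthogonal of the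
    -- interpretation, `neg (sub k ρ A)` in the interpretation itself. Each half calls the other at
    -- a negation.
    ⟦⟧-⊑ : ∀ {k} ρ A → BelowEnv k ρ A → ⟦ A ⟧ ρ ⊑ sub k ρ A
    ⟦⟧-⊑ ρ 𝖿 b = Provable-⊑
    ⟦⟧-⊑ ρ 𝗍 b = ⊑-𝗍
    ⟦⟧-⊑ ρ (atom (mkAtom ± p ts)) b = ⟦atom⟧-⊑ ± p (tsubs ρ ts)
    ⟦⟧-⊑ {k} ρ (disj (R ∷ Rs)) b =
      ⊑-≈ (⊑-∨ (⊥-stable (⟦ R ⟧ ρ)) (⋂⟦⟧-stable Rs Sign.- ρ)
             (⊑-⊆ (⟦⟧-stable R ρ) (⟦⟧-⊑ ρ R λ i → b (disj (here i))))
             (⋂⟦⟧⊥-⊑ ρ Rs λ i → b (disj (there i))))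
          (≈-sym (disj-∷ _ (subList k ρ Rs)))
    ⟦⟧-⊑ {k} ρ (conj (R ∷ Rs)) b =
      ⊑-≈ (⊑-∧ (⟦⟧-⊑ ρ R λ i → b (conj (here i))) (⋂⟦⟧-⊑ ρ Rs λ i → b (conj (there i))))
          (≈-sym (conj-∷ _ (subList k ρ Rs)))
    ⟦⟧-⊑ ρ (neg R) b = ⟦⟧⊥-⊑ ρ R λ i → b (neg i)
    ⟦⟧-⊑ {k} ρ (ex x R) b =
      ⊑-∃ (λ t → ⊥-stable (⟦ R ⟧ (ρ [ x ≔ t ]))) λ t →
        ⊑-⊆ (⟦⟧-stable R (ρ [ x ≔ t ])) (⟦⟧-⊑-ex ρ x R t (BelowBody-ex b))
    ⟦⟧-⊑ {k} ρ (all x R) b = ⊑-∀ k λ l k≤l →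
      _ , ⟦⟧-⊑ (ρ [ x ≔ var l ]) R (BelowEnv-update ρ x R (m≤n⇒m≤1+n k≤l) (BelowBody-all b) (Below-var l))
        , quant-level ∀′ ρ x R (BelowBody-≤ k≤l (BelowBody-all b)) (BelowBody-all b)

    -- The level is raised above `t` so that `n↓` applies with witness `t`, and is lowered again
    -- under the new quantifier.
    ⟦⟧-⊑-ex : ∀ {k} ρ x A t → BelowBody k ρ x A →
              ⟦ A ⟧ (ρ [ x ≔ t ]) ⊑ ex k (sub (suc k) (ρ [ x ≔ var k ]) A)
    ⟦⟧-⊑-ex {k} ρ x A t b =
      let m , k<m , t<m , e = instantiate-above ρ x A t b
      in ⊑-≈ (⊑-ex (sub-freeFor (ρ [ x ≔ var k ]) A t<m)
               (⊑-≈ (⟦⟧-⊑ (ρ [ x ≔ t ]) A (BelowEnv-update ρ x A (<⇒≤ k<m) b t<m)) (≡⇒≈ e)))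
             (≈-sym (body-level ∃′ ρ x A b k<m))

    ⟦⟧⊥-⊑ : ∀ {k} ρ A → BelowEnv k ρ A → ⟦ A ⟧ ρ ⊥ ⊑ neg (sub k ρ A)
    ⟦⟧⊥-⊑ ρ 𝖿 b = ⊑-≈ ⊑-𝗍 (≈-sym neg-𝖿)
    ⟦⟧⊥-⊑ ρ 𝗍 b = U⊥-⊑
    ⟦⟧⊥-⊑ ρ (atom (mkAtom ± p ts)) b = ⟦atom⟧⊥-⊑ ± p (tsubs ρ ts)
    ⟦⟧⊥-⊑ {k} ρ (disj (R ∷ Rs)) b =
      ⊑-⊆ (∩-stable (⊥-stable (⟦ R ⟧ ρ)) (⋂⟦⟧-stable Rs Sign.- ρ))
        (⊑-≈ (⊑-∧ (⟦⟧⊥-⊑ ρ R λ i → b (disj (here i))) (⋂⟦⟧-⊑-¬⋁ ρ Rs λ i → b (disj (there i))))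
             (¬⋁-∷ _ (subList k ρ Rs)))
    ⟦⟧⊥-⊑ {k} ρ (conj (R ∷ Rs)) b =
      ⊑-≈ (⊑-∨ (⟦⟧-stable R ρ) (⋂⟦⟧-stable Rs Sign.+ ρ)
             (⟦⟧⊥-⊑ ρ R λ i → b (conj (here i))) (⋂⟦⟧⊥-⊑-¬⋀ ρ Rs λ i → b (conj (there i))))
          (¬⋀-∷ _ (subList k ρ Rs))
    ⟦⟧⊥-⊑ ρ (neg R) b =
      ⊑-⊆ (⟦⟧-stable R ρ) (⊑-≈ (⟦⟧-⊑ ρ R λ i → b (neg i)) (≈-sym (neg-neg _)))
    ⟦⟧⊥-⊑ {k} ρ (ex x R) b =
      ⊑-⊆ (⋂-stable λ t → ⊥-stable (⟦ R ⟧ (ρ [ x ≔ t ]))) (⊑-∀ k λ l k≤l →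
        _ , ⟦⟧⊥-⊑ (ρ [ x ≔ var l ]) R (BelowEnv-update ρ x R (m≤n⇒m≤1+n k≤l) (BelowBody-ex b) (Below-var l))
          , ≈-trans (≈-sym (neg-ex l _))
              (neg-cong (quant-level ∃′ ρ x R (BelowBody-≤ k≤l (BelowBody-ex b)) (BelowBody-ex b))))
    ⟦⟧⊥-⊑ ρ (all x R) b =
      ⊑-∃ (λ t → ⟦⟧-stable R (ρ [ x ≔ t ])) λ t → ⟦⟧⊥-⊑-all ρ x R t (BelowBody-all b)

    ⟦⟧⊥-⊑-all : ∀ {k} ρ x A t → BelowBody k ρ x A →
                ⟦ A ⟧ (ρ [ x ≔ t ]) ⊥ ⊑ neg (all k (sub (suc k) (ρ [ x ≔ var k ]) A))
    ⟦⟧⊥-⊑-all {k} ρ x A t b =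
      let m , k<m , t<m , e = instantiate-above ρ x A t b
      -- `n↓` acts on the negated body; the resulting ∃ becomes a negated ∀ by duality.
      in ⊑-≈ (⊑-ex (neg (sub-freeFor (ρ [ x ≔ var k ]) A t<m))
               (⊑-≈ (⟦⟧⊥-⊑ (ρ [ x ≔ t ]) A (BelowEnv-update ρ x A (<⇒≤ k<m) b t<m)) (≡⇒≈ (cong neg e))))
             (≈-trans (≈-sym (neg-all k _)) (neg-cong (≈-sym (body-level ∀′ ρ x A b k<m))))

    ⋂⟦⟧-⊑ : ∀ {k} ρ Rs → (∀ {z} → Anyˡ (z FreeIn_) Rs → Below k (ρ z)) →
            ⋂⟦ Rs ⟧ Sign.+ ρ ⊑ ⋀ (subList k ρ Rs)
    ⋂⟦⟧-⊑ ρ []       b = ⊑-𝗍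
    ⋂⟦⟧-⊑ {k} ρ (R ∷ Rs) b =
      ⊑-≈ (⊑-∧ (⟦⟧-⊑ ρ R λ i → b (here i)) (⋂⟦⟧-⊑ ρ Rs λ i → b (there i)))
          (≈-sym (conj-∷ _ (subList k ρ Rs)))

    ⋂⟦⟧⊥-⊑ : ∀ {k} ρ Rs → (∀ {z} → Anyˡ (z FreeIn_) Rs → Below k (ρ z)) →
             ⋂⟦ Rs ⟧ Sign.- ρ ⊥ ⊑ ⋁ (subList k ρ Rs)
    ⋂⟦⟧⊥-⊑ ρ []       b = U⊥-⊑
    ⋂⟦⟧⊥-⊑ {k} ρ (R ∷ Rs) b =
      ⊑-≈ (⊑-∨ (⊥-stable (⟦ R ⟧ ρ)) (⋂⟦⟧-stable Rs Sign.- ρ)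
             (⊑-⊆ (⟦⟧-stable R ρ) (⟦⟧-⊑ ρ R λ i → b (here i)))
             (⋂⟦⟧⊥-⊑ ρ Rs λ i → b (there i)))
          (≈-sym (disj-∷ _ (subList k ρ Rs)))

    ⋂⟦⟧-⊑-¬⋁ : ∀ {k} ρ Rs → (∀ {z} → Anyˡ (z FreeIn_) Rs → Below k (ρ z)) →
               ⋂⟦ Rs ⟧ Sign.- ρ ⊑ neg (⋁ (subList k ρ Rs))
    ⋂⟦⟧-⊑-¬⋁ ρ []       b = ⊑-≈ ⊑-𝗍 (≈-sym neg-𝖿)
    ⋂⟦⟧-⊑-¬⋁ {k} ρ (R ∷ Rs) b =
      ⊑-≈ (⊑-∧ (⟦⟧⊥-⊑ ρ R λ i → b (here i)) (⋂⟦⟧-⊑-¬⋁ ρ Rs λ i → b (there i)))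
          (¬⋁-∷ _ (subList k ρ Rs))

    ⋂⟦⟧⊥-⊑-¬⋀ : ∀ {k} ρ Rs → (∀ {z} → Anyˡ (z FreeIn_) Rs → Below k (ρ z)) →
                ⋂⟦ Rs ⟧ Sign.+ ρ ⊥ ⊑ neg (⋀ (subList k ρ Rs))
    ⋂⟦⟧⊥-⊑-¬⋀ ρ []       b = U⊥-⊑
    ⋂⟦⟧⊥-⊑-¬⋀ {k} ρ (R ∷ Rs) b =
      ⊑-≈ (⊑-∨ (⟦⟧-stable R ρ) (⋂⟦⟧-stable Rs Sign.+ ρ)
             (⟦⟧⊥-⊑ ρ R λ i → b (here i)) (⋂⟦⟧⊥-⊑-¬⋀ ρ Rs λ i → b (there i)))
          (¬⋀-∷ _ (subList k ρ Rs))

  ⊨-complete : ∀ {R} → 𝗍 ⊨ R → Provable R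
  ⊨-complete {R} h =
    -- At a level above its free variables, R in the identity environment is R up to renaming.
    let k , b = boundStructure R
        below : BelowEnv k var R
        below = λ { z∈ var → b z∈ }
    in ⟦⟧-⊑ var R below 𝖿 (h var 𝖿 tt) ▷ ≈-trans (𝖿∨ _) (sub-id R below)

  admissible : ∀ ρ → Admissible ρ KSgq
  admissible ρ R d = ⊨-complete (derivation-sound d)

theorem4p11 : (𝓛 : Signature) → let open Calculus 𝓛 in
    Admissible i↑ KSgq × Admissible w↑ KSgq × Admissible c↑ KSgq × Admissible u↑ KSgq × Admissible n↑ KSgq
theorem4p11 𝓛 = admissible 𝓛 i↑ , admissible 𝓛 w↑ , admissible 𝓛 c↑ , admissible 𝓛 u↑ , admissible 𝓛 n↑
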